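{- For positive integers $m,n$ and $0\le k\le\min\{m,n\}$, let $\tau_k(K_{m,n})$ denote the number of spanning trees of the complete bipartite graph $K_{m,n}$ containing all edges of a given matching of size $k$ (this number depends only on $k$). Then for any $1\le k\le \min\{m,n\}-1$, $$\frac{\tau_{k+1}(K_{m,n})}{\tau_k(K_{m,n})}=\frac{(m+n)(m+n-k-1)}{mn(m+n-k)}.$$ -}

module Defs where

open import Data.Nat using (ℕ; zero; suc; _≤_)
open import Data.Fin using (Fin; zero; suc)
open import Data.Bool using (Bool; true; false)
open import Data.Sum using (_⊎_; inj₁; inj₂)
open import Data.Product using (Σ; ∃; _×_; _,_)
open import Data.Empty using (⊥)
open import Data.List using (List; []; _∷_; [_]; _++_; _∷ʳ_; length; concatMap; map; filter)
open import Data.List.Relation.Unary.Unique.Propositional using (Unique)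
open import Data.List.Relation.Unary.Linked using (Linked)
open import Relation.Binary.PropositionalEquality using (_≡_)
open import Relation.Binary.Construct.Closure.ReflexiveTransitive using (Star)
open import Relation.Nullary using (¬_)
open import Relation.Unary using (Decidable)
open import Function.Definitions using (Injective)

Vertex : ℕ → ℕ → Set
Vertex m n = Fin m ⊎ Fin n

-- A spanning subgraph of K_{m,n} is given by its edge set:
-- edge {i , j} is present iff S i j ≡ true.
EdgeSet : ℕ → ℕ → Set
EdgeSet m n = Fin m → Fin n → Bool

Adj : ∀ {m n} → EdgeSet m n → Vertex m n → Vertex m n → Set
Adj S (inj₁ i) (inj₂ j) = S i j ≡ true
Adj S (inj₂ j) (inj₁ i) = S i j ≡ true
Adj S (inj₁ _) (inj₁ _) = ⊥
Adj S (inj₂ _) (inj₂ _) = ⊥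

Reachable : ∀ {m n} → EdgeSet m n → Vertex m n → Vertex m n → Set
Reachable S = Star (Adj S)

Connected : ∀ {m n} → EdgeSet m n → Set
Connected S = ∀ u v → Reachable S u v

Cycle : ∀ {m n} → EdgeSet m n → Set
Cycle {m} {n} S =
  Σ (Vertex m n) λ v → Σ (List (Vertex m n)) λ ws →
    (2 ≤ length ws) × Unique (v ∷ ws) × Linked (Adj S) ((v ∷ ws) ∷ʳ v)

Acyclic : ∀ {m n} → EdgeSet m n → Set
Acyclic S = ¬ Cycle S

IsSpanningTree : ∀ {m n} → EdgeSet m n → Set
IsSpanningTree S = Connected S × Acyclic S

-- A matching of size k in K_{m,n}: edges (f a , g a), a : Fin k, with
-- f and g injective (so the k edges are pairwise vertex-disjoint).
record Matching (k m n : ℕ) : Set where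
  field
    left     : Fin k → Fin m
    right    : Fin k → Fin n
    left-inj  : Injective _≡_ _≡_ left
    right-inj : Injective _≡_ _≡_ right
open Matching public

Contains : ∀ {k m n} → EdgeSet m n → Matching k m n → Set
Contains S M = ∀ a → S (left M a) (right M a) ≡ true

SpanningTreeContaining : ∀ {k m n} → Matching k m n → EdgeSet m n → Set
SpanningTreeContaining M S = IsSpanningTree S × Contains S M

-- Enumeration of all edge sets (each appears exactly once)

allBoolFns : (k : ℕ) → List (Fin k → Bool)
allBoolFns zero    = (λ ()) ∷ []
allBoolFns (suc k) =
  concatMap (λ b → map (λ r → λ { zero → b ; (suc i) → r i }) (allBoolFns k))
            (true ∷ false ∷ [])

allEdgeSets : (m n : ℕ) → List (EdgeSet m n)
allEdgeSets zero    n = (λ ()) ∷ []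
allEdgeSets (suc m) n =
  concatMap (λ row → map (λ rest → λ { zero → row ; (suc i) → rest i })
                         (allEdgeSets m n))
            (allBoolFns n)

countEdgeSets : ∀ {m n} {P : EdgeSet m n → Set} → Decidable P → ℕ
countEdgeSets {m} {n} dec = length (filter dec (allEdgeSets m n))

-- τ(M) : number of spanning trees of K_{m,n} containing all edges of M.
-- Parametrised by (any) decision procedure for the predicate; the value
-- does not depend on which one is chosen.
τ : ∀ {k m n} (M : Matching k m n) → Decidable (SpanningTreeContaining M) → ℕ
τ M dec = countEdgeSets dec

{-# OPTIONS --safe #-}
-- Let F be a forest in K_{m,n} whose component x has a_x left and b_x right vertices, and put
-- d_x = n a_x + m b_x.  The number τ(F) of spanning trees containing F satisfies
--
--     m n τ(F) = (∏_x d_x) (1 - ∑_x a_x b_x / d_x).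
--
-- If F has N components, every spanning tree containing F has N - 1 edges outside F, all joining
-- different components, so (N - 1) τ(F) = ∑_e τ(F + e) over the edges e between components, and
-- the formula follows by induction on N.  A matching of size k is a forest with k components
-- of type (1,1) and m + n - 2k isolated vertices, so m n τ_k is a constant independent of k times
-- ((m + n) / (m n))^k (1 - k / (m + n)), which gives the ratio.
module Submission where

open import Defs
open import Algebra.Bundles using (CommutativeMonoid; CommutativeRing)
import Algebra.Properties.CommutativeMonoid.Sum
import Algebra.Properties.CommutativeSemigroup
import Algebra.Properties.Group
import Algebra.Properties.Semiring.Mult
import Algebra.Properties.Semiring.Sum
open import Data.Bool using (Bool; true; false; _∧_; _∨_; if_then_else_)
import Data.Bool.Properties as Bool
open import Data.Fin using (Fin; zero; suc; punchIn; punchOut; join; splitAt)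
open import Data.Fin.Properties using (_≟_; all?; 0≢1+n; suc-injective; join-splitAt; splitAt-join; punchIn-injective; punchInᵢ≢i; punchIn-punchOut; punchOut-punchIn; punchOut-cong)
open import Data.List as List using (List; []; _∷_; _++_; _∷ʳ_; length; filter; concatMap)
import Data.List.Membership.DecPropositional as DecMembership
open import Data.List.Membership.Propositional using (_∈_; _∉_)
open import Data.List.Properties using (map-++; map-∘)
open import Data.List.Relation.Unary.All using ([]; _∷_)
open import Data.List.Relation.Unary.All.Properties using (¬Any⇒All¬; All¬⇒¬Any)
open import Data.List.Relation.Unary.AllPairs using ([]; _∷_)
open import Data.List.Relation.Unary.Any using (here; there)
open import Data.List.Relation.Unary.Linked as Linked using (Linked; [-]; _∷_)
open import Data.List.Relation.Unary.Unique.Propositional using (Unique)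
open import Data.Nat as ℕ using (ℕ; zero; suc; z≤n; s≤s)
open import Data.Nat.ListAction using () renaming (sum to sumₗ)
open import Data.Nat.ListAction.Properties using (sum-++)
import Data.Nat.Properties as ℕ
open import Data.Product using (∃; ∃₂; _×_; _,_; proj₁; proj₂)
open import Data.Rational using (ℚ; 0ℚ; 1ℚ; 1/_; Positive; NonNegative)
import Data.Rational.Properties as ℚ
open import Data.Rational.Solver using (module +-*-Solver)
open import Data.Sum using (_⊎_; inj₁; inj₂; [_,_]′)
open import Data.Sum.Properties using (inj₁-injective; inj₂-injective; ≡-dec)
open import Data.Vec.Functional using (removeAt) renaming (_∷_ to _∷ᶠ_)
open import Function using (_∘_; case_of_)
open import Level using (0ℓ)
open import Relation.Binary using (DecidableEquality; Rel)
open import Relation.Binary.Construct.Closure.ReflexiveTransitive as Star using (Star; ε; _◅_; _◅◅_)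
import Relation.Binary.Reasoning.Setoid
open import Relation.Binary.PropositionalEquality using (_≡_; _≢_; _≗_; refl; sym; trans; cong; cong₂; subst; module ≡-Reasoning)
open import Relation.Nullary using (¬_; Dec; yes; no; contradiction; does; ¬?)
open import Relation.Nullary.Decidable using (dec-true; dec-false; _×-dec_; _→-dec_)
open import Relation.Unary using (Decidable)

-- The formula is a matrix-tree identity in disguise. Left vertices of K_{m,n} have degree n and
-- right ones degree m, so d_x is the total degree of component x, and contracting the components
-- gives a multigraph with Laplacian diag(d) - a b^T - b a^T, a rank-two perturbation of a diagonal
-- matrix. The determinant is therefore governed by ∏ d and the sums of a²/d, ab/d and b²/d, which n
-- a + m b = d reduces to ∑ ab/d alone. The induction replaces the determinant by one identity.
-- Joining components x and y multiplies ∏ d (1 - ∑ ab/d) by an explicit factor once ∏ d is taken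
-- out; summing that factor with weights a_x b_y over all x ≠ y must give (N - 1)(1 - ∑ ab/d). All
-- pairs are summed, then the diagonal is subtracted. Components are the fibres of a labelling into
-- `Fin N`, so joining two of them is a map on labels and their types are fibre sizes. The d_x are
-- divided by, so the weights live in ℚ; the counts enter through the embedding `ι`, whose
-- injectivity returns the final equation to ℕ.

private variable
  m n N : ℕ

-- Merging two labels

_≟ᵛ_ : DecidableEquality (Vertex m n)
_≟ᵛ_ = ≡-dec _≟_ _≟_

inj₂≢inj₁ : ∀ {i : Fin m} {j : Fin n} → _≢_ {A = Vertex m n} (inj₂ j) (inj₁ i)
inj₂≢inj₁ ()

-- Merges label y into label punchIn y x, renumbering the others.
merge : Fin (suc N) → Fin N → Fin (suc N) → Fin N
merge y x z with y ≟ z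
... | yes _  = x
... | no y≢z = punchOut y≢z

merge-removed : ∀ (y : Fin (suc N)) x → merge y x y ≡ x
merge-removed y x with y ≟ y
... | yes _  = refl
... | no y≢y = contradiction refl y≢y

merge-punchIn : ∀ (y : Fin (suc N)) x z → merge y x (punchIn y z) ≡ z
merge-punchIn y x z with y ≟ punchIn y z
... | yes y≡ = contradiction (sym y≡) (punchInᵢ≢i y z)
... | no y≢  = trans (punchOut-cong y refl) (punchOut-punchIn y)

removed-or-punchIn : ∀ (y z : Fin (suc N)) → z ≡ y ⊎ ∃ λ w → z ≡ punchIn y w
removed-or-punchIn y z with y ≟ z
... | yes y≡z = inj₁ (sym y≡z)
... | no y≢z  = inj₂ (punchOut y≢z , sym (punchIn-punchOut y≢z))

-- Only `y` and `punchIn y x` are identified. Listing the cases lets both the completeness of a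
-- merged labelling and the isolation of untouched vertices be read off.
merge-kernel : ∀ (y : Fin (suc N)) x z w → merge y x z ≡ merge y x w →
  z ≡ w ⊎ (z ≡ punchIn y x × w ≡ y) ⊎ (z ≡ y × w ≡ punchIn y x)
merge-kernel y x z w eq with removed-or-punchIn y z | removed-or-punchIn y w
... | inj₁ refl | inj₁ refl = inj₁ refl
... | inj₁ refl | inj₂ (w′ , refl) = inj₂ (inj₂ (refl , cong (punchIn y)
        (trans (sym (merge-punchIn y x w′)) (trans (sym eq) (merge-removed y x)))))
... | inj₂ (z′ , refl) | inj₁ refl = inj₂ (inj₁ (cong (punchIn y)
        (trans (sym (merge-punchIn y x z′)) (trans eq (merge-removed y x))) , refl))
... | inj₂ (z′ , refl) | inj₂ (w′ , refl) = inj₁ (cong (punchIn y)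
        (trans (sym (merge-punchIn y x z′)) (trans eq (merge-punchIn y x w′))))

-- Adding an edge to an edge set

_⊆_ : EdgeSet m n → EdgeSet m n → Set
F ⊆ S = ∀ i j → F i j ≡ true → S i j ≡ true

singleEdge : Fin m → Fin n → EdgeSet m n
singleEdge i j i′ j′ = does (i ≟ i′) ∧ does (j ≟ j′)

addEdge : EdgeSet m n → Fin m → Fin n → EdgeSet m n
addEdge F i j i′ j′ = F i′ j′ ∨ singleEdge i j i′ j′

singleEdge-self : ∀ (i : Fin m) (j : Fin n) → singleEdge i j i j ≡ true
singleEdge-self i j rewrite dec-true (i ≟ i) refl | dec-true (j ≟ j) refl = refl

singleEdge-sound : ∀ {i : Fin m} {j : Fin n} {i′ j′} → singleEdge i j i′ j′ ≡ true → i ≡ i′ × j ≡ j′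
singleEdge-sound {i = i} {j} {i′} {j′} eq with i ≟ i′ | j ≟ j′
... | yes p | yes q = p , q

addEdge-sound : ∀ (F : EdgeSet m n) i j i′ j′ → addEdge F i j i′ j′ ≡ true →
  F i′ j′ ≡ true ⊎ (i ≡ i′ × j ≡ j′)
addEdge-sound F i j i′ j′ eq with F i′ j′
... | true  = inj₁ refl
... | false = inj₂ (singleEdge-sound eq)

addEdge-new : ∀ (F : EdgeSet m n) i j → addEdge F i j i j ≡ true
addEdge-new F i j rewrite singleEdge-self i j with F i j
... | true  = refl
... | false = refl

addEdge-old : ∀ (F : EdgeSet m n) i j → F ⊆ addEdge F i j
addEdge-old F i j i′ j′ eq rewrite eq = refl

addEdge-least : ∀ {F S : EdgeSet m n} {i j} → F ⊆ S → S i j ≡ true → addEdge F i j ⊆ S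
addEdge-least {F = F} {i = i} {j} F⊆S Sij i′ j′ eq with addEdge-sound F i j i′ j′ eq
... | inj₁ Fij          = F⊆S i′ j′ Fij
... | inj₂ (refl , refl) = Sij

Adj-mono : ∀ {F S : EdgeSet m n} → F ⊆ S → ∀ {u v} → Adj F u v → Adj S u v
Adj-mono F⊆S {inj₁ i} {inj₂ j} = F⊆S i j
Adj-mono F⊆S {inj₂ j} {inj₁ i} = F⊆S i j

Adj-sym : ∀ {F : EdgeSet m n} {u v} → Adj F u v → Adj F v u
Adj-sym {u = inj₁ i} {inj₂ j} e = e
Adj-sym {u = inj₂ j} {inj₁ i} e = e

Reachable-sym : ∀ {F : EdgeSet m n} {u v} → Reachable F u v → Reachable F v u
Reachable-sym {F = F} = Star.reverse (λ {u} {v} → Adj-sym {F = F} {u} {v})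

SameEdge : (p q u v : Vertex m n) → Set
SameEdge p q u v = (u ≡ p × v ≡ q) ⊎ (u ≡ q × v ≡ p)

SameEdge-trans : ∀ {p q p′ q′ u v : Vertex m n} → SameEdge p q p′ q′ → SameEdge p q u v → SameEdge p′ q′ u v
SameEdge-trans (inj₁ (refl , refl)) s = s
SameEdge-trans (inj₂ (refl , refl)) s = [ inj₂ , inj₁ ]′ s

Adj-addEdge : ∀ {F : EdgeSet m n} {i j u v} → Adj (addEdge F i j) u v →
  Adj F u v ⊎ SameEdge (inj₁ i) (inj₂ j) u v
Adj-addEdge {F = F} {i} {j} {inj₁ i′} {inj₂ j′} e with addEdge-sound F i j i′ j′ e
... | inj₁ Fe            = inj₁ Fe
... | inj₂ (refl , refl) = inj₂ (inj₁ (refl , refl))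
Adj-addEdge {F = F} {i} {j} {inj₂ j′} {inj₁ i′} e with addEdge-sound F i j i′ j′ e
... | inj₁ Fe            = inj₁ Fe
... | inj₂ (refl , refl) = inj₂ (inj₂ (refl , refl))

-- Bridges, simple paths and cycles

AdjAvoiding : EdgeSet m n → (p q u v : Vertex m n) → Set
AdjAvoiding F p q u v = Adj F u v × ¬ SameEdge p q u v

-- Acyclicity in a form that is easy to preserve when an edge is added.
AllBridges : EdgeSet m n → Set
AllBridges F = ∀ p q → Adj F p q → ¬ Star (AdjAvoiding F p q) q p

avoiding-tail : ∀ {F : EdgeSet m n} {p q} x xs → p ≢ q → q ∉ (x ∷ xs) → Linked (Adj F) ((x ∷ xs) ∷ʳ p) →
  Star (AdjAvoiding F p q) x p
avoiding-tail x [] p≢q q∉ (e ∷ _) =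
  (e , λ { (inj₁ (_ , p≡q)) → p≢q p≡q ; (inj₂ (x≡q , _)) → q∉ (here (sym x≡q)) }) ◅ ε
avoiding-tail x (y ∷ ys) p≢q q∉ (e ∷ es) =
  (e , λ { (inj₁ (_ , y≡q)) → q∉ (there (here (sym y≡q))) ; (inj₂ (x≡q , _)) → q∉ (here (sym x≡q)) })
  ◅ avoiding-tail y ys p≢q (q∉ ∘ there) es

-- On a cycle v w₁ … the walk w₁ … v avoids the edge {v, w₁}, since v and w₁ occur only at its ends.
AllBridges⇒Acyclic : ∀ {F : EdgeSet m n} → AllBridges F → Acyclic F
AllBridges⇒Acyclic bridges (v , w ∷ [] , s≤s () , _)
AllBridges⇒Acyclic {F = F} bridges (v , w ∷ w₂ ∷ ws , _ , (v∉@(v≢w ∷ v≢w₂ ∷ _) ∷ w∉ ∷ _) , e ∷ e₂ ∷ es) =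
  bridges v w e
    ((e₂ , λ { (inj₁ (w≡v , _)) → v≢w (sym w≡v) ; (inj₂ (_ , w₂≡v)) → v≢w₂ (sym w₂≡v) })
     ◅ avoiding-tail w₂ ws v≢w (All¬⇒¬Any w∉) es)

module _ {V : Set} (_≟_ : DecidableEquality V) {R : Rel V 0ℓ} {t : V} where

  open DecMembership _≟_ using (_∈?_)

  -- The target `t` heads the uniqueness list and ends the linked list, as the base vertex does in
  -- `Cycle`, so prepending an edge from `t` to `u` closes the path without any rearrangement.
  SimplePath : V → List V → Set
  SimplePath u us = Unique (t ∷ u ∷ us) × Linked R ((u ∷ us) ∷ʳ t)

  suffix : ∀ {u v us} → SimplePath v us → u ∈ (v ∷ us) → ∃ λ ws → SimplePath u ws
  suffix {us = us} path (here refl) = us , path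
  suffix {us = w ∷ us} (((_ ∷ t∉) ∷ (_ ∷ uniq)) , (_ ∷ link)) (there u∈) = suffix ((t∉ ∷ uniq) , link) u∈

  -- Loop erasure from the back: if the new first vertex already lies on the erased path, that path
  -- is cut there; otherwise the vertex is prepended.
  loopErase : ∀ {u} → Star R u t → u ≡ t ⊎ ∃ (SimplePath u)
  loopErase ε = inj₁ refl
  loopErase {u} (e ◅ es) with u ≟ t
  ... | yes u≡t = inj₁ u≡t
  ... | no u≢t with loopErase es
  ...   | inj₁ refl = inj₂ ([] , (((u≢t ∘ sym) ∷ []) ∷ [] ∷ []) , e ∷ [-])
  ...   | inj₂ (us , path@((t∉ ∷ uniq) , link)) with u ∈? (_ ∷ us)
  ...     | yes u∈ = inj₂ (suffix path u∈)
  ...     | no  u∉ = inj₂ (_ ∷ us , (((u≢t ∘ sym) ∷ t∉) ∷ ¬Any⇒All¬ _ u∉ ∷ uniq) , e ∷ link)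

path+edge⇒Cycle : ∀ {F S : EdgeSet m n} {u t} → F ⊆ S → u ≢ t → Reachable F u t →
  Adj S t u → ¬ Adj F u t → Cycle S
path+edge⇒Cycle {F = F} {S} {u} {t} F⊆S u≢t walk e ¬f with loopErase _≟ᵛ_ walk
... | inj₁ u≡t = contradiction u≡t u≢t
-- A path of one edge would only give the closed walk t u t, too short for `Cycle`; non-adjacency in
-- `F` excludes it.
... | inj₂ ([] , _ , f ∷ _) = contradiction f ¬f
... | inj₂ (w ∷ us , uniq , link) =
  t , u ∷ w ∷ us , s≤s (s≤s z≤n) , uniq , e ∷ Linked.map (λ {x} {y} → Adj-mono F⊆S {x} {y}) link

-- Forests with labelled components

-- `sound` and `complete` make the fibres of `c` the connected components, and `surjective` makes
-- `N` their number.
record IsForest (F : EdgeSet m n) (c : Vertex m n → Fin N) : Set where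
  field
    surjective : ∀ x → ∃ λ v → c v ≡ x
    sound      : ∀ {i j} → F i j ≡ true → c (inj₁ i) ≡ c (inj₂ j)
    complete   : ∀ {u v} → c u ≡ c v → Reachable F u v
    bridges    : AllBridges F

  Adj-sound : ∀ {u v} → Adj F u v → c u ≡ c v
  Adj-sound {inj₁ i} {inj₂ j} e = sound e
  Adj-sound {inj₂ j} {inj₁ i} e = sym (sound e)

  Reachable-sound : ∀ {u v} → Reachable F u v → c u ≡ c v
  Reachable-sound ε = refl
  Reachable-sound (e ◅ es) = trans (Adj-sound e) (Reachable-sound es)

-- A stretch that leaves one end of the extra edge {p, q} and later returns to it can be cut out, so
-- at most one crossing of that edge remains.
star-split : ∀ {V : Set} {R R′ : Rel V 0ℓ} {p q : V} →
  (∀ {u v} → R′ u v → R u v ⊎ (u ≡ p × v ≡ q) ⊎ (u ≡ q × v ≡ p)) →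
  ∀ {u v} → Star R′ u v →
  Star R u v ⊎ (Star R u p × Star R q v) ⊎ (Star R u q × Star R p v)
star-split step ε = inj₁ ε
star-split step (e ◅ es) with step e | star-split step es
... | inj₁ r | inj₁ s = inj₁ (r ◅ s)
... | inj₁ r | inj₂ (inj₁ (s , s′)) = inj₂ (inj₁ (r ◅ s , s′))
... | inj₁ r | inj₂ (inj₂ (s , s′)) = inj₂ (inj₂ (r ◅ s , s′))
... | inj₂ (inj₁ (refl , refl)) | inj₁ s = inj₂ (inj₁ (ε , s))
... | inj₂ (inj₁ (refl , refl)) | inj₂ (inj₁ (_ , s′)) = inj₂ (inj₁ (ε , s′))
... | inj₂ (inj₁ (refl , refl)) | inj₂ (inj₂ (_ , s′)) = inj₁ s′
... | inj₂ (inj₂ (refl , refl)) | inj₁ s = inj₂ (inj₂ (ε , s))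
... | inj₂ (inj₂ (refl , refl)) | inj₂ (inj₁ (_ , s′)) = inj₁ s′
... | inj₂ (inj₂ (refl , refl)) | inj₂ (inj₂ (_ , s′)) = inj₂ (inj₂ (ε , s′))

module _ {F : EdgeSet m n} {c : Vertex m n → Fin N} (forest : IsForest F c) where
  open IsForest forest

  -- A walk around the new edge stays in `F` and would join two components. A walk around an old
  -- edge {p, q} that crosses the new edge once leaves two pieces in `F`; these pieces and {p, q}
  -- itself connect `inj₁ i` to `inj₂ j` inside `F`.
  addEdge-bridges : ∀ {i j} → c (inj₁ i) ≢ c (inj₂ j) → AllBridges (addEdge F i j)
  addEdge-bridges {i} {j} ci≢cj p q e walk with Adj-addEdge {F = F} {i} {j} {p} {q} e
  ... | inj₂ same = [ (λ { (refl , refl) → ci≢cj (sym (Reachable-sound oldWalk)) })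
                    , (λ { (refl , refl) → ci≢cj (Reachable-sound oldWalk) }) ]′ same
    where
    oldStep : ∀ {u v} → AdjAvoiding (addEdge F i j) p q u v → Adj F u v
    oldStep {u} {v} (f , f≢) with Adj-addEdge {F = F} {i} {j} {u} {v} f
    ... | inj₁ f′ = f′
    ... | inj₂ s  = contradiction (SameEdge-trans same s) f≢
    oldWalk : Reachable F q p
    oldWalk = Star.map oldStep walk
  ... | inj₁ e′ = case star-split step walk of λ
      { (inj₁ s)              → bridges p q e′ s
      ; (inj₂ (inj₁ (s , s′))) → ci≢cj (trans (sym (same s)) (trans (sym (Adj-sound e′)) (sym (same s′))))
      ; (inj₂ (inj₂ (s , s′))) → ci≢cj (trans (same s′) (trans (Adj-sound e′) (same s))) }
    where
    step : ∀ {u v} → AdjAvoiding (addEdge F i j) p q u v →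
      AdjAvoiding F p q u v ⊎ SameEdge (inj₁ i) (inj₂ j) u v
    step {u} {v} (f , f≢) with Adj-addEdge {F = F} {i} {j} {u} {v} f
    ... | inj₁ f′ = inj₁ (f′ , f≢)
    ... | inj₂ s  = inj₂ s
    same : ∀ {u v} → Star (AdjAvoiding F p q) u v → c u ≡ c v
    same = Reachable-sound ∘ Star.map proj₁

  crossing-edge : ∀ {S u v} → Reachable S u v → c u ≢ c v →
    ∃₂ λ i j → S i j ≡ true × c (inj₁ i) ≢ c (inj₂ j)
  crossing-edge ε cu≢cv = contradiction refl cu≢cv
  crossing-edge {S} {u} (_◅_ {j = w} e es) cu≢cv with c u ≟ c w
  ... | yes cu≡cw = crossing-edge es (cu≢cv ∘ trans cu≡cw)
  crossing-edge {S} {inj₁ i} (_◅_ {j = inj₂ j} e es) _ | no cu≢cw = i , j , e , cu≢cw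
  crossing-edge {S} {inj₂ j} (_◅_ {j = inj₁ i} e es) _ | no cu≢cw = i , j , e , cu≢cw ∘ sym

  -- With equal labels, an `F`-path between the ends and the new edge would form a cycle of `S`.
  new-edge-crosses : ∀ {S} → Acyclic S → F ⊆ S →
    ∀ {i j} → S i j ≡ true → F i j ≢ true → c (inj₁ i) ≢ c (inj₂ j)
  new-edge-crosses acyclic F⊆S e ¬f ci≡cj =
    acyclic (path+edge⇒Cycle F⊆S (λ ()) (complete ci≡cj) e ¬f)

-- The hypothesis names the label of `i` as it stands once the label of `j` is deleted, which also
-- says that the two differ.
addEdge-forest : ∀ {F : EdgeSet m n} {c : Vertex m n → Fin (suc N)} → IsForest F c →
  ∀ {i j x} → c (inj₁ i) ≡ punchIn (c (inj₂ j)) x →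
  IsForest (addEdge F i j) (merge (c (inj₂ j)) x ∘ c)
addEdge-forest {m} {n} {N} {F} {c} forest {i} {j} {x} ci≡ = record
  { surjective = λ z → let v , cv≡ = surjective (punchIn y z) in v , trans (cong (merge y x) cv≡) (merge-punchIn y x z)
  ; sound = sound′
  ; complete = λ {u} {v} eq → complete′ u v (merge-kernel y x (c u) (c v) eq)
  ; bridges = addEdge-bridges forest (λ eq → punchInᵢ≢i y x (trans (sym ci≡) eq))
  }
  where
  open IsForest forest
  y = c (inj₂ j)
  sound′ : ∀ {i′ j′} → addEdge F i j i′ j′ ≡ true → merge y x (c (inj₁ i′)) ≡ merge y x (c (inj₂ j′))
  sound′ {i′} {j′} e with addEdge-sound F i j i′ j′ e
  ... | inj₁ f = cong (merge y x) (sound f)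
  ... | inj₂ (refl , refl) =
    trans (cong (merge y x) ci≡) (trans (merge-punchIn y x x) (sym (merge-removed y x)))
  old : ∀ {u v} → c u ≡ c v → Reachable (addEdge F i j) u v
  old eq = Star.map (λ {u} {v} → Adj-mono (addEdge-old F i j) {u} {v}) (complete eq)
  new : Reachable (addEdge F i j) (inj₁ i) (inj₂ j)
  new = addEdge-new F i j ◅ ε
  complete′ : ∀ u v → c u ≡ c v ⊎ (c u ≡ punchIn y x × c v ≡ y) ⊎ (c u ≡ y × c v ≡ punchIn y x) →
    Reachable (addEdge F i j) u v
  complete′ u v (inj₁ eq) = old eq
  complete′ u v (inj₂ (inj₁ (p , q))) = old (trans p (sym ci≡)) ◅◅ new ◅◅ old (sym q)
  complete′ u v (inj₂ (inj₂ (p , q))) =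
    old p ◅◅ Reachable-sym new ◅◅ old (trans ci≡ (sym q))

fin1 : (x y : Fin 1) → x ≡ y
fin1 zero zero = refl

one-component : ∀ {F : EdgeSet m n} {c : Vertex m n → Fin 1} → IsForest F c → IsSpanningTree F
one-component {c = c} forest = (λ u v → complete (fin1 (c u) (c v))) , AllBridges⇒Acyclic bridges
  where open IsForest forest

-- Sums changed or supported at one index

module SumProperties {c ℓ} (M : CommutativeMonoid c ℓ) where
  open CommutativeMonoid M hiding (refl; sym; trans) renaming (ε to 0#)
  open Algebra.Properties.CommutativeMonoid.Sum M
    using (sum-cong-≋) renaming (sum to ∑; sum-remove to ∑-remove; sum-replicate-zero to ∑-replicate-0#)
  open Relation.Binary.Reasoning.Setoid setoid
  open Algebra.Properties.CommutativeSemigroup commutativeSemigroup using (xy∙z≈zy∙x)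

  -- One term is added on each side so that nothing is subtracted: the same lemma then serves sums
  -- and products in ℚ.
  sum-update : ∀ {N} (f g : Fin N → Carrier) j → (∀ i → i ≢ j → f i ≈ g i) → ∑ f ∙ g j ≈ ∑ g ∙ f j
  sum-update {suc N} f g j f≈g = begin
    ∑ f ∙ g j                     ≈⟨ ∙-congʳ (∑-remove f) ⟩
    (f j ∙ ∑ (removeAt f j)) ∙ g j ≈⟨ ∙-congʳ (∙-congˡ (sum-cong-≋ λ i → f≈g _ (punchInᵢ≢i j i))) ⟩
    (f j ∙ ∑ (removeAt g j)) ∙ g j ≈⟨ xy∙z≈zy∙x _ _ _ ⟩
    (g j ∙ ∑ (removeAt g j)) ∙ f j ≈⟨ ∙-congʳ (∑-remove g) ⟨
    ∑ g ∙ f j                     ∎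

  sum-concentrated : ∀ {N} (f : Fin N → Carrier) j → (∀ i → i ≢ j → f i ≈ 0#) → ∑ f ≈ f j
  sum-concentrated {suc N} f j f≈0# = begin
    ∑ f                          ≈⟨ ∑-remove f ⟩
    f j ∙ ∑ (removeAt f j)       ≈⟨ ∙-congˡ (sum-cong-≋ λ i → f≈0# _ (punchInᵢ≢i j i)) ⟩
    f j ∙ ∑ (λ (_ : Fin N) → 0#)  ≈⟨ ∙-congˡ (∑-replicate-0# N) ⟩
    f j ∙ 0#                     ≈⟨ identityʳ _ ⟩
    f j                          ∎

-- Counting by indicator sums

module Counting where

  open import Data.Nat using (_+_; _*_)
  open Algebra.Properties.Semiring.Sum ℕ.+-*-semiring
    using (sum; ∑-distrib-+; sum-cong-≗; sum-replicate-zero; sum-remove)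

  open SumProperties ℕ.+-0-commutativeMonoid using (sum-concentrated)

  𝟙 : ∀ {a} {A : Set a} → Dec A → ℕ
  𝟙 d = if does d then 1 else 0

  𝟙-true : ∀ {a} {A : Set a} (d : Dec A) → A → 𝟙 d ≡ 1
  𝟙-true d a rewrite dec-true d a = refl

  𝟙-false : ∀ {a} {A : Set a} (d : Dec A) → ¬ A → 𝟙 d ≡ 0
  𝟙-false d ¬a rewrite dec-false d ¬a = refl

  𝟙-cong : ∀ {a b} {A : Set a} {B : Set b} (d : Dec A) (e : Dec B) → (A → B) → (B → A) → 𝟙 d ≡ 𝟙 e
  𝟙-cong (yes a) e f g = sym (𝟙-true e (f a))
  𝟙-cong (no ¬a) e f g = sym (𝟙-false e (¬a ∘ g))

  ∑ₗ : ∀ {A : Set} → List A → (A → ℕ) → ℕ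
  ∑ₗ xs f = sumₗ (List.map f xs)

  ∑ₗ-cong : ∀ {A : Set} {f g : A → ℕ} xs → f ≗ g → ∑ₗ xs f ≡ ∑ₗ xs g
  ∑ₗ-cong []       f≗g = refl
  ∑ₗ-cong (x ∷ xs) f≗g = cong₂ _+_ (f≗g x) (∑ₗ-cong xs f≗g)

  ∑ₗ-zero : ∀ {A : Set} {f : A → ℕ} xs → (∀ x → f x ≡ 0) → ∑ₗ xs f ≡ 0
  ∑ₗ-zero []       f≡0 = refl
  ∑ₗ-zero (x ∷ xs) f≡0 = cong₂ _+_ (f≡0 x) (∑ₗ-zero xs f≡0)

  ∑ₗ-*ˡ : ∀ {A : Set} k (f : A → ℕ) xs → k * ∑ₗ xs f ≡ ∑ₗ xs (λ x → k * f x)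
  ∑ₗ-*ˡ k f []       = ℕ.*-zeroʳ k
  ∑ₗ-*ˡ k f (x ∷ xs) = trans (ℕ.*-distribˡ-+ k (f x) _) (cong (k * f x +_) (∑ₗ-*ˡ k f xs))

  ∑ₗ-∑-comm : ∀ {A : Set} {k} (f : A → Fin k → ℕ) xs → ∑ₗ xs (λ x → sum (f x)) ≡ sum (λ i → ∑ₗ xs (λ x → f x i))
  ∑ₗ-∑-comm {k = k} f []       = sym (sum-replicate-zero k)
  ∑ₗ-∑-comm {k = k} f (x ∷ xs) = trans (cong (sum (f x) +_) (∑ₗ-∑-comm f xs)) (sym (∑-distrib-+ (f x) _))

  ∑ₗ-concatMap : ∀ {A B : Set} (f : A → List B) w xs → ∑ₗ (concatMap f xs) w ≡ ∑ₗ xs (λ x → ∑ₗ (f x) w)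
  ∑ₗ-concatMap f w []       = refl
  ∑ₗ-concatMap f w (x ∷ xs) = trans (cong sumₗ (map-++ w (f x) (concatMap f xs)))
    (trans (sum-++ (List.map w (f x)) _) (cong (∑ₗ (f x) w +_) (∑ₗ-concatMap f w xs)))

  length-filter : ∀ {A : Set} {P : A → Set} (P? : Decidable P) xs → length (filter P? xs) ≡ ∑ₗ xs (𝟙 ∘ P?)
  length-filter P? []       = refl
  length-filter P? (x ∷ xs) with P? x
  ... | yes _ = cong suc (length-filter P? xs)
  ... | no  _ = length-filter P? xs

  -- Enumerations up to an equivalence

  -- Each class occurs exactly once. The weight `w` stands for the indicator of the class of `a` and
  -- is constrained only by its values, so any decision procedure can be plugged in, and edge sets
  -- can be compared pointwise.
  record Enumerates {A : Set} (_≈_ : A → A → Set) (xs : List A) : Set where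
    field
      ∑-indicator : ∀ (w : A → ℕ) a → (∀ x → x ≈ a → w x ≡ 1) → (∀ x → ¬ x ≈ a → w x ≡ 0) → ∑ₗ xs w ≡ 1

  open Enumerates

  -- For fixed `x` the inner sum is 1 if `x` is in the class of `a` and 0 otherwise, so it is itself
  -- an indicator to which the outer enumeration applies.
  concatMap-enumerates : ∀ {A B C : Set} {_≈ᵃ_ : A → A → Set} {_≈ᵇ_ : B → B → Set} {_≈ᶜ_ : C → C → Set}
    {xs ys} {f : A → B → C} → Enumerates _≈ᵃ_ xs → Enumerates _≈ᵇ_ ys →
    (∀ c → ∃₂ λ a b → (∀ x y → x ≈ᵃ a → y ≈ᵇ b → f x y ≈ᶜ c) × (∀ x y → f x y ≈ᶜ c → x ≈ᵃ a × y ≈ᵇ b)) →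
    Enumerates _≈ᶜ_ (concatMap (λ x → List.map (f x) ys) xs)
  concatMap-enumerates {xs = xs} {ys} {f} exs eys split .∑-indicator w c w≡1 w≡0 with split c
  ... | a , b , join , proj = begin
    ∑ₗ (concatMap (λ x → List.map (f x) ys) xs) w  ≡⟨ ∑ₗ-concatMap _ w xs ⟩
    ∑ₗ xs (λ x → ∑ₗ (List.map (f x) ys) w)         ≡⟨ ∑ₗ-cong xs (λ x → cong sumₗ (sym (map-∘ ys))) ⟩
    ∑ₗ xs (λ x → ∑ₗ ys (w ∘ f x))                  ≡⟨ ∑-indicator exs _ a
        (λ x x≈a → ∑-indicator eys _ b (λ y y≈b → w≡1 _ (join x y x≈a y≈b)) (λ y y≉b → w≡0 _ (y≉b ∘ proj₂ ∘ proj x y)))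
        (λ x x≉a → ∑ₗ-zero ys (λ y → w≡0 _ (x≉a ∘ proj₁ ∘ proj x y))) ⟩
    1 ∎
    where open ≡-Reasoning

  Bool-enumerates : Enumerates _≡_ (true ∷ false ∷ [])
  Bool-enumerates .∑-indicator w true  w≡1 w≡0 rewrite w≡1 true refl | w≡0 false (λ ()) = refl
  Bool-enumerates .∑-indicator w false w≡1 w≡0 rewrite w≡1 false refl | w≡0 true (λ ()) = refl

  -- This is the form to which `concatMap` over the two Booleans unfolds; with `f₁` and `f₀` as
  -- separate implicit arguments, unification finds the anonymous functions in `allBoolFns`.
  two-copies-enumerate : ∀ {B C : Set} {_≈ᵇ_ : B → B → Set} {_≈ᶜ_ : C → C → Set} {ys} {f₁ f₀ : B → C} →
    let f : Bool → B → C
        f b = if b then f₁ else f₀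
    in Enumerates _≈ᵇ_ ys →
    (∀ c → ∃₂ λ a b → (∀ x y → x ≡ a → y ≈ᵇ b → f x y ≈ᶜ c) × (∀ x y → f x y ≈ᶜ c → x ≡ a × y ≈ᵇ b)) →
    Enumerates _≈ᶜ_ (List.map f₁ ys ++ List.map f₀ ys ++ [])
  two-copies-enumerate {f₁ = f₁} {f₀} =
    concatMap-enumerates {f = λ b → if b then f₁ else f₀} Bool-enumerates

  allBoolFns-enumerates : ∀ k → Enumerates _≗_ (allBoolFns k)
  allBoolFns-enumerates zero .∑-indicator w g w≡1 w≡0 = cong (_+ 0) (w≡1 _ (λ ()))
  allBoolFns-enumerates (suc k) =
    two-copies-enumerate (allBoolFns-enumerates k) λ g →
      g zero , g ∘ suc
    , (λ { true y p q zero → p ; true y p q (suc i) → q i ; false y p q zero → p ; false y p q (suc i) → q i })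
    , (λ { true y p → p zero , p ∘ suc ; false y p → p zero , p ∘ suc })

  _≗₂_ : EdgeSet m n → EdgeSet m n → Set
  S ≗₂ T = ∀ i → S i ≗ T i

  allEdgeSets-enumerates : ∀ m n → Enumerates _≗₂_ (allEdgeSets m n)
  allEdgeSets-enumerates zero n .∑-indicator w g w≡1 w≡0 = cong (_+ 0) (w≡1 _ (λ ()))
  allEdgeSets-enumerates (suc m) n = concatMap-enumerates (allBoolFns-enumerates n) (allEdgeSets-enumerates m n) λ g →
    g zero , g ∘ suc , (λ { x y p q zero → p ; x y p q (suc i) → q i }) , (λ x y p → p zero , p ∘ suc)

  -- Edges of a tree outside a forest

  _⊆?_ : (F S : EdgeSet m n) → Dec (F ⊆ S)
  F ⊆? S = all? λ i → all? λ j → (F i j Bool.≟ true) →-dec (S i j Bool.≟ true)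

  ∑₂ : (Fin m → Fin n → ℕ) → ℕ
  ∑₂ f = sum (λ i → sum (f i))

  ∑₂-cong : ∀ {f g : Fin m → Fin n → ℕ} → (∀ i j → f i j ≡ g i j) → ∑₂ f ≡ ∑₂ g
  ∑₂-cong f≡g = sum-cong-≗ (λ i → sum-cong-≗ (f≡g i))

  ∑₂-zero : ∀ {f : Fin m → Fin n → ℕ} → (∀ i j → f i j ≡ 0) → ∑₂ f ≡ 0
  ∑₂-zero {m} {n} f≡0 = trans (sum-cong-≗ (λ i → trans (sum-cong-≗ (f≡0 i)) (sum-replicate-zero n))) (sum-replicate-zero m)

  new? : (S F : EdgeSet m n) → ∀ i j → Dec (S i j ≡ true × F i j ≢ true)
  new? S F i j = (S i j Bool.≟ true) ×-dec ¬? (F i j Bool.≟ true)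

  newEdges : EdgeSet m n → EdgeSet m n → ℕ
  newEdges S F = ∑₂ λ i j → 𝟙 (new? S F i j)

  ∑₂-single : ∀ (i : Fin m) (j : Fin n) → ∑₂ (λ i′ j′ → 𝟙 ((i ≟ i′) ×-dec (j ≟ j′))) ≡ 1
  ∑₂-single {m} {n} i j = trans
    (sum-concentrated _ i λ i′ i′≢i → trans (sum-cong-≗ λ j′ → 𝟙-false ((i ≟ i′) ×-dec (j ≟ j′)) (i′≢i ∘ sym ∘ proj₁)) (sum-replicate-zero n))
    (trans (sum-concentrated _ j λ j′ j′≢j → 𝟙-false ((i ≟ i) ×-dec (j ≟ j′)) (j′≢j ∘ sym ∘ proj₂))
           (𝟙-true ((i ≟ i) ×-dec (j ≟ j)) (refl , refl)))

  newEdges-addEdge : ∀ {S F : EdgeSet m n} {i j} → S i j ≡ true → F i j ≢ true →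
    newEdges S F ≡ suc (newEdges S (addEdge F i j))
  newEdges-addEdge {m} {n} {S} {F} {i} {j} Sij ¬Fij = begin
    newEdges S F                                        ≡⟨ ∑₂-cong pointwise ⟩
    ∑₂ (λ i′ j′ → single i′ j′ + rest i′ j′)            ≡⟨ sum-cong-≗ (λ i′ → ∑-distrib-+ (single i′) (rest i′)) ⟩
    sum (λ i′ → sum (single i′) + sum (rest i′))        ≡⟨ ∑-distrib-+ (λ i′ → sum (single i′)) _ ⟩
    ∑₂ single + ∑₂ rest                                 ≡⟨ cong (_+ ∑₂ rest) (∑₂-single i j) ⟩
    suc (newEdges S (addEdge F i j))                    ∎
    where
    open ≡-Reasoning
    single rest : Fin m → Fin n → ℕ
    single i′ j′ = 𝟙 ((i ≟ i′) ×-dec (j ≟ j′))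
    rest i′ j′ = 𝟙 (new? S (addEdge F i j) i′ j′)
    pointwise : ∀ i′ j′ → 𝟙 (new? S F i′ j′) ≡ single i′ j′ + rest i′ j′
    pointwise i′ j′ = by-cases ((i ≟ i′) ×-dec (j ≟ j′))
      where
      by-cases : (d : Dec (i ≡ i′ × j ≡ j′)) → 𝟙 (new? S F i′ j′) ≡ 𝟙 d + rest i′ j′
      by-cases (yes (refl , refl)) = trans (𝟙-true (new? S F i j) (Sij , ¬Fij))
            (cong suc (sym (𝟙-false (new? S (addEdge F i j) i j) (λ (_ , ¬new) → ¬new (addEdge-new F i j)))))
      by-cases (no ≢ij) = 𝟙-cong (new? S F i′ j′) (new? S (addEdge F i j) i′ j′)
            (λ (s , ¬f) → s , λ f′ → [ ¬f , ≢ij ]′ (addEdge-sound F i j i′ j′ f′))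
            (λ (s , ¬f′) → s , ¬f′ ∘ addEdge-old F i j i′ j′)

  addCrossing-forest : ∀ {F : EdgeSet m n} {c : Vertex m n → Fin (suc N)} → IsForest F c →
    ∀ {i j} → (ci≢cj : c (inj₂ j) ≢ c (inj₁ i)) →
    IsForest (addEdge F i j) (merge (c (inj₂ j)) (punchOut ci≢cj) ∘ c)
  addCrossing-forest forest ci≢cj = addEdge-forest forest (sym (punchIn-punchOut ci≢cj))

  -- Connectedness of `S` supplies an edge between two labels; adding it to `F` lowers both sides by
  -- one. With a single label any new edge would close a cycle.
  newEdges-count : ∀ {S F : EdgeSet m n} {c : Vertex m n → Fin (suc N)} →
    IsSpanningTree S → F ⊆ S → IsForest F c → newEdges S F ≡ N
  newEdges-count {N = zero} {S} {F} {c} tree F⊆S forest = ∑₂-zero λ i j →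
    𝟙-false (new? S F i j) λ (s , ¬f) → new-edge-crosses forest (proj₂ tree) F⊆S s ¬f (fin1 _ _)
  newEdges-count {N = suc N} {S} {F} {c} tree F⊆S forest =
    let u , cu≡0 = surjective zero
        v , cv≡1 = surjective (suc zero)
        i , j , Sij , ci≢cj = crossing-edge forest (proj₁ tree u v)
          (λ cu≡cv → 0≢1+n (trans (sym cu≡0) (trans cu≡cv cv≡1)))
    in trans (newEdges-addEdge {S = S} {F} Sij (ci≢cj ∘ sound))
         (cong suc (newEdges-count tree (addEdge-least F⊆S Sij) (addCrossing-forest forest (ci≢cj ∘ sym))))
    where open IsForest forest

  -- Counting trees containing a forest

  IsSpanningTree-resp : ∀ {S T : EdgeSet m n} → S ≗₂ T → IsSpanningTree T → IsSpanningTree S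
  IsSpanningTree-resp S≗T (connected , acyclic) =
      (λ u v → Star.map (λ {x} {y} → Adj-mono (λ i j → trans (S≗T i j)) {x} {y}) (connected u v))
    , (λ (v , ws , len , uniq , link) → acyclic (v , ws , len , uniq ,
         Linked.map (λ {x} {y} → Adj-mono (λ i j → trans (sym (S≗T i j))) {x} {y}) link))

  -- Deciding Q for the supersets of a single F₀ is enough to count the trees containing any F ⊇ F₀.
  module TreeCount {m n} {Q : EdgeSet m n → Set} (Q? : Decidable Q) {F₀ : EdgeSet m n}
    (Q⇒tree : ∀ {S} → Q S → IsSpanningTree S) (tree⇒Q : ∀ {S} → IsSpanningTree S → F₀ ⊆ S → Q S) where

    counted? : ∀ F S → Dec (Q S × F ⊆ S)
    counted? F S = Q? S ×-dec (F ⊆? S)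

    trees : EdgeSet m n → ℕ
    trees F = ∑ₗ (allEdgeSets m n) (λ S → 𝟙 (counted? F S))

    crosses? : ∀ {N} (c : Vertex m n → Fin N) i j → Dec (c (inj₂ j) ≢ c (inj₁ i))
    crosses? c i j = ¬? (c (inj₂ j) ≟ c (inj₁ i))

    -- A forest with one component is the only tree above itself: a further edge would have to join
    -- two different labels.
    trees-spanning : ∀ {F} {c : Vertex m n → Fin 1} → F₀ ⊆ F → IsForest F c → trees F ≡ 1
    trees-spanning {F} {c} F₀⊆F forest = ∑-indicator (allEdgeSets-enumerates m n) _ F
      (λ S S≗F → 𝟙-true (counted? F S)
        ( tree⇒Q (IsSpanningTree-resp S≗F (one-component forest)) (λ i j → trans (S≗F i j) ∘ F₀⊆F i j)
        , λ i j → trans (S≗F i j)))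
      (λ S S≗̸F → 𝟙-false (counted? F S) λ (q , F⊆S) → S≗̸F λ i j → equal S q F⊆S i j)
      where
      equal : ∀ S → Q S → F ⊆ S → S ≗₂ F
      equal S q F⊆S i j with F i j in Fij
      ... | true = F⊆S i j Fij
      ... | false with S i j in Sij
      ...   | false = refl
      ...   | true  = contradiction (fin1 _ _) (new-edge-crosses forest (proj₂ (Q⇒tree q)) F⊆S Sij
                (λ t → case trans (sym Fij) t of λ ()))

    -- Pairs of a tree `S` above `F` and an edge of `S` outside `F` are counted in two ways. For
    -- such `S` the new edges are exactly its crossing edges; for any other `S` all terms vanish.
    trees-recurrence : ∀ {N F} {c : Vertex m n → Fin (suc N)} → IsForest F c →
      N * trees F ≡ ∑₂ (λ i j → 𝟙 (crosses? c i j) * trees (addEdge F i j))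
    trees-recurrence {N} {F} {c} forest = begin
      N * trees F                                                   ≡⟨ ∑ₗ-*ˡ N _ L ⟩
      ∑ₗ L (λ S → N * 𝟙 (counted? F S))                              ≡⟨ ∑ₗ-cong L pointwise ⟩
      ∑ₗ L (λ S → ∑₂ (term S))                                       ≡⟨ ∑ₗ-∑-comm (λ S i → sum (term S i)) L ⟩
      sum (λ i → ∑ₗ L (λ S → sum (term S i)))                        ≡⟨ sum-cong-≗ (λ i → ∑ₗ-∑-comm (λ S → term S i) L) ⟩
      ∑₂ (λ i j → ∑ₗ L (λ S → term S i j))                           ≡⟨ ∑₂-cong (λ i j → sym (∑ₗ-*ˡ (𝟙 (crosses? c i j)) (λ S → 𝟙 (counted? (addEdge F i j) S)) L)) ⟩
      ∑₂ (λ i j → 𝟙 (crosses? c i j) * trees (addEdge F i j))        ∎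
      where
      open ≡-Reasoning
      open IsForest forest
      L = allEdgeSets m n
      term : EdgeSet m n → Fin m → Fin n → ℕ
      term S i j = 𝟙 (crosses? c i j) * 𝟙 (counted? (addEdge F i j) S)
      term-zero : ∀ S i j → ¬ (Q S × addEdge F i j ⊆ S) → term S i j ≡ 0
      term-zero S i j ¬counted =
        trans (cong (𝟙 (crosses? c i j) *_) (𝟙-false (counted? _ S) ¬counted)) (ℕ.*-zeroʳ (𝟙 (crosses? c i j)))
      pointwise : ∀ S → N * 𝟙 (counted? F S) ≡ ∑₂ (term S)
      pointwise S = by-cases (counted? F S)
        where
        by-cases : (d : Dec (Q S × F ⊆ S)) → N * 𝟙 d ≡ ∑₂ (term S)
        by-cases (no ¬counted) = trans (ℕ.*-zeroʳ N) (sym (∑₂-zero λ i j → term-zero S i j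
              λ (q , F′⊆S) → ¬counted (q , λ i′ j′ → F′⊆S i′ j′ ∘ addEdge-old F i j i′ j′)))
        by-cases (yes (q , F⊆S)) = trans (ℕ.*-identityʳ N) (trans
              (sym (newEdges-count (Q⇒tree q) F⊆S forest)) (∑₂-cong new≡term))
          where
          new≡term : ∀ i j → 𝟙 (new? S F i j) ≡ term S i j
          new≡term i j = split (S i j Bool.≟ true)
            where
            split : (d : Dec (S i j ≡ true)) → 𝟙 (d ×-dec ¬? (F i j Bool.≟ true)) ≡ term S i j
            split (no ¬s) = sym (term-zero S i j λ (_ , F′⊆S) → ¬s (F′⊆S i j (addEdge-new F i j)))
            split (yes s) = begin
                𝟙 (¬? (F i j Bool.≟ true))  ≡⟨ 𝟙-cong (¬? (F i j Bool.≟ true)) (crosses? c i j)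
                    (λ ¬f → new-edge-crosses forest (proj₂ (Q⇒tree q)) F⊆S s ¬f ∘ sym) (λ ≢ f → ≢ (sym (sound f))) ⟩
                𝟙 (crosses? c i j)          ≡⟨ ℕ.*-identityʳ _ ⟨
                𝟙 (crosses? c i j) * 1      ≡⟨ cong (𝟙 (crosses? c i j) *_) (𝟙-true (counted? _ S) (q , addEdge-least F⊆S s)) ⟨
                term S i j                  ∎

  -- Component sizes as fibre sizes

  fibre : ∀ {p} → (Fin p → Fin N) → Fin N → ℕ
  fibre f x = sum (λ i → 𝟙 (f i ≟ x))

  module _ {p} (f : Fin p → Fin (suc N)) (y : Fin (suc N)) (x : Fin N) where

    fibre-merge-same : fibre (merge y x ∘ f) x ≡ fibre f (punchIn y x) + fibre f y
    fibre-merge-same = trans (sum-cong-≗ λ i → pointwise (f i)) (∑-distrib-+ (λ i → 𝟙 (f i ≟ punchIn y x)) _)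
      where
      pointwise : ∀ z → 𝟙 (merge y x z ≟ x) ≡ 𝟙 (z ≟ punchIn y x) + 𝟙 (z ≟ y)
      pointwise z with removed-or-punchIn y z
      ... | inj₁ refl rewrite merge-removed y x = trans (𝟙-true (x ≟ x) refl) (sym (cong₂ _+_
              (𝟙-false (y ≟ punchIn y x) (punchInᵢ≢i y x ∘ sym)) (𝟙-true (y ≟ y) refl)))
      ... | inj₂ (w , refl) rewrite merge-punchIn y x w = trans (sym (ℕ.+-identityʳ _)) (cong₂ _+_
              (𝟙-cong (w ≟ x) (punchIn y w ≟ punchIn y x) (cong (punchIn y)) (punchIn-injective y w x))
              (sym (𝟙-false (punchIn y w ≟ y) (punchInᵢ≢i y w))))

    fibre-merge-other : ∀ z → z ≢ x → fibre (merge y x ∘ f) z ≡ fibre f (punchIn y z)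
    fibre-merge-other z z≢x = sum-cong-≗ λ i → pointwise (f i)
      where
      pointwise : ∀ w → 𝟙 (merge y x w ≟ z) ≡ 𝟙 (w ≟ punchIn y z)
      pointwise w with removed-or-punchIn y w
      ... | inj₁ refl rewrite merge-removed y x = 𝟙-cong (x ≟ z) (y ≟ punchIn y z)
              (λ x≡z → contradiction (sym x≡z) z≢x) (λ eq → contradiction (sym eq) (punchInᵢ≢i y z))
      ... | inj₂ (v , refl) rewrite merge-punchIn y x v =
              𝟙-cong (v ≟ z) (punchIn y v ≟ punchIn y z) (cong (punchIn y)) (punchIn-injective y v z)

  fibre-empty : ∀ {p} (f : Fin p → Fin N) x → (∀ i → f i ≢ x) → fibre f x ≡ 0
  fibre-empty {p = p} f x f≢x = trans (sum-cong-≗ λ i → 𝟙-false (f i ≟ x) (f≢x i)) (sum-replicate-zero p)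

  fibre-singleton : ∀ {p} (f : Fin p → Fin N) i → (∀ i′ → f i′ ≡ f i → i′ ≡ i) → fibre f (f i) ≡ 1
  fibre-singleton f i unique = trans
    (sum-concentrated _ i λ i′ i′≢i → 𝟙-false (f i′ ≟ f i) (i′≢i ∘ unique i′)) (𝟙-true (f i ≟ f i) refl)

  fibre-nonempty : ∀ {p} (f : Fin p → Fin N) i → ∃ λ k → fibre f (f i) ≡ suc k
  fibre-nonempty {p = suc p} f i = _ , trans (sum-remove {i = i} (λ i′ → 𝟙 (f i′ ≟ f i)))
    (cong (_+ sum (removeAt (λ i′ → 𝟙 (f i′ ≟ f i)) i)) (𝟙-true (f i ≟ f i) refl))

-- Counts as rational numbers

module Weights where

  open Counting
  open import Data.Rational using (_+_; _*_; -_; _-_)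
  open import Data.Rational.Properties using (pos+nonNeg⇒pos; pos⇒nonNeg; pos⇒nonZero; *-inverseʳ; *-comm; *-assoc; *-identityˡ; *-identityʳ; *-zeroʳ; *-zeroˡ; +-identityʳ; +-identityˡ; +-comm)
  open CommutativeRing ℚ.+-*-commutativeRing using (semiring; +-group)
  open Algebra.Properties.Group +-group using (∙-cancelˡ)
  open Algebra.Properties.Semiring.Mult semiring using (×-homo-+; ×1-homo-*) renaming (_×_ to _·_)
  open Algebra.Properties.Semiring.Sum semiring
    using (sum; ∑-comm; ∑-distrib-+; sum-cong-≗; sum-replicate; sum-replicate-zero; *-distribˡ-sum; *-distribʳ-sum; sum-remove)
  open Algebra.Properties.CommutativeMonoid.Sum ℚ.*-1-commutativeMonoid using () renaming (sum to prod; sum-remove to prod-remove)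
  open SumProperties ℚ.+-0-commutativeMonoid using (sum-update; sum-concentrated)
  open SumProperties ℚ.*-1-commutativeMonoid using () renaming (sum-update to prod-update)
  open +-*-Solver using (solve; _:=_; _:+_; _:*_; _:-_; :-_; con)
  module ℕSum = Algebra.Properties.Semiring.Sum ℕ.+-*-semiring

  ι : ℕ → ℚ
  ι k = k · 1ℚ

  ι-+ : ∀ j k → ι (j ℕ.+ k) ≡ ι j + ι k
  ι-+ j k = ×-homo-+ 1ℚ j k

  ι-* : ∀ j k → ι (j ℕ.* k) ≡ ι j * ι k
  ι-* = ×1-homo-*

  ι-nonNegative : ∀ k → NonNegative (ι k)
  ι-positive : ∀ k → Positive (ι (suc k))
  ι-nonNegative zero    = _
  ι-nonNegative (suc k) = pos⇒nonNeg (ι (suc k)) {{ι-positive k}}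
  ι-positive k = pos+nonNeg⇒pos 1ℚ (ι k) {{ι-nonNegative k}}

  -- The default value 0 makes 1/d total, so weights can be written for every labelling;
  -- surjectivity of the labelling later makes each d non-zero.
  ι⁻¹ : ℕ → ℚ
  ι⁻¹ zero    = 0ℚ
  ι⁻¹ (suc k) = (1/ ι (suc k)) {{pos⇒nonZero (ι (suc k)) {{ι-positive k}}}}

  ι-inverse : ∀ k → .{{ℕ.NonZero k}} → ι k * ι⁻¹ k ≡ 1ℚ
  ι-inverse (suc k) = *-inverseʳ (ι (suc k)) {{pos⇒nonZero (ι (suc k)) {{ι-positive k}}}}

  *-cancelˡ-inverse : ∀ k k⁻¹ {p q} → k * k⁻¹ ≡ 1ℚ → k * p ≡ k * q → p ≡ q
  *-cancelˡ-inverse k k⁻¹ {p} {q} inv eq = trans (sym (undo p)) (trans (cong (k⁻¹ *_) eq) (undo q))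
    where
    undo : ∀ r → k⁻¹ * (k * r) ≡ r
    undo r = trans (sym (*-assoc k⁻¹ k r)) (trans (cong (_* r) (trans (*-comm k⁻¹ k) inv)) (*-identityˡ r))

  ι-cancelˡ : ∀ k → .{{ℕ.NonZero k}} → ∀ {p q} → ι k * p ≡ ι k * q → p ≡ q
  ι-cancelˡ k = *-cancelˡ-inverse (ι k) (ι⁻¹ k) (ι-inverse k)

  ι-injective : ∀ j k → ι j ≡ ι k → j ≡ k
  ι-injective zero    zero    eq = refl
  ι-injective zero    (suc k) eq = contradiction (trans (sym (ι-inverse (suc k))) (trans (cong (_* ι⁻¹ (suc k)) (sym eq)) (*-zeroˡ (ι⁻¹ (suc k))))) λ ()
  ι-injective (suc j) zero    eq = contradiction (trans (sym (ι-inverse (suc j))) (trans (cong (_* ι⁻¹ (suc j)) eq) (*-zeroˡ (ι⁻¹ (suc j))))) λ ()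
  ι-injective (suc j) (suc k) eq = cong suc (ι-injective j k (∙-cancelˡ 1ℚ (ι j) (ι k) eq))

  ι-sum : ∀ {k} (f : Fin k → ℕ) → ι (ℕSum.sum f) ≡ sum (ι ∘ f)
  ι-sum {zero}  f = refl
  ι-sum {suc k} f = trans (ι-+ (f zero) _) (cong (ι (f zero) +_) (ι-sum (f ∘ suc)))

  -- Rearranging sums over vertices and components

  sum-fibres : ∀ {p} (f : Fin p → Fin N) (g : Fin N → ℚ) → sum (λ i → g (f i)) ≡ sum (λ x → ι (fibre f x) * g x)
  sum-fibres {N} {p} f g = begin
    sum (λ i → g (f i))                              ≡⟨ sum-cong-≗ (λ i → sym (at i)) ⟩
    sum (λ i → sum (λ x → ι (𝟙 (f i ≟ x)) * g x))    ≡⟨ ∑-comm (λ i x → ι (𝟙 (f i ≟ x)) * g x) ⟩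
    sum (λ x → sum (λ i → ι (𝟙 (f i ≟ x)) * g x))    ≡⟨ sum-cong-≗ (λ x → sym (*-distribʳ-sum (g x) (λ i → ι (𝟙 (f i ≟ x))))) ⟩
    sum (λ x → sum (λ i → ι (𝟙 (f i ≟ x))) * g x)    ≡⟨ sum-cong-≗ (λ x → cong (_* g x) (sym (ι-sum (λ i → 𝟙 (f i ≟ x))))) ⟩
    sum (λ x → ι (fibre f x) * g x)                  ∎
    where
    open ≡-Reasoning
    at : ∀ i → sum (λ x → ι (𝟙 (f i ≟ x)) * g x) ≡ g (f i)
    at i = trans
      (sum-concentrated (λ x → ι (𝟙 (f i ≟ x)) * g x) (f i) λ x x≢ →
        trans (cong (λ k → ι k * g x) (𝟙-false (f i ≟ x) (x≢ ∘ sym))) (*-zeroˡ (g x)))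
      (trans (cong (λ k → ι k * g (f i)) (𝟙-true (f i ≟ f i) refl)) (*-identityˡ (g (f i))))

  sum-fibre : ∀ {p} (f : Fin p → Fin N) → sum (λ x → ι (fibre f x)) ≡ ι p
  sum-fibre {p = p} f = begin
    sum (λ x → ι (fibre f x))        ≡⟨ sum-cong-≗ (λ x → sym (*-identityʳ (ι (fibre f x)))) ⟩
    sum (λ x → ι (fibre f x) * 1ℚ)   ≡⟨ sum-fibres f (λ _ → 1ℚ) ⟨
    sum {p} (λ _ → 1ℚ)               ≡⟨ sum-replicate p ⟩
    ι p                              ∎
    where open ≡-Reasoning

  sum-linear : ∀ {k} p q (f g : Fin k → ℚ) → p * sum f + q * sum g ≡ sum (λ x → p * f x + q * g x)
  sum-linear p q f g = trans (cong₂ _+_ (*-distribˡ-sum p f) (*-distribˡ-sum q g)) (sym (∑-distrib-+ (λ x → p * f x) (λ x → q * g x)))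

  sum-product : ∀ {j k} (f : Fin j → ℚ) (g : Fin k → ℚ) → sum (λ x → sum (λ y → f x * g y)) ≡ sum f * sum g
  sum-product f g = trans (sum-cong-≗ (λ x → sym (*-distribˡ-sum (f x) g))) (sym (*-distribʳ-sum (sum g) f))

  -- The summand is a matrix of rank at most `r` written as `r` outer products, each of which sums
  -- to a product.
  sum-rank : ∀ {r j k} (f : Fin r → Fin j → ℚ) (g : Fin r → Fin k → ℚ) →
    sum (λ x → sum (λ y → sum (λ s → f s x * g s y))) ≡ sum (λ s → sum (f s) * sum (g s))
  sum-rank f g = begin
    sum (λ x → sum (λ y → sum (λ s → f s x * g s y))) ≡⟨ sum-cong-≗ (λ x → ∑-comm (λ y s → f s x * g s y)) ⟩
    sum (λ x → sum (λ s → sum (λ y → f s x * g s y))) ≡⟨ ∑-comm (λ x s → sum (λ y → f s x * g s y)) ⟩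
    sum (λ s → sum (λ x → sum (λ y → f s x * g s y))) ≡⟨ sum-cong-≗ (λ s → sum-product (f s) (g s)) ⟩
    sum (λ s → sum (f s) * sum (g s))                 ∎
    where open ≡-Reasoning

  sum-off-diagonal : ∀ {k} (f : Fin k → ℚ) x → sum (λ y → ι (𝟙 (¬? (y ≟ x))) * f y) + f x ≡ sum f
  sum-off-diagonal f x = begin
    sum off + f x                                    ≡⟨ cong (sum off +_) at-x ⟨
    sum off + sum on                                 ≡⟨ ∑-distrib-+ off on ⟨
    sum (λ y → off y + on y)                         ≡⟨ sum-cong-≗ (λ y → pointwise y (y ≟ x)) ⟩
    sum f                                            ∎
    where
    open ≡-Reasoning
    off on : _ → ℚ
    off y = ι (𝟙 (¬? (y ≟ x))) * f y
    on y = ι (𝟙 (y ≟ x)) * f y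
    at-x : sum on ≡ f x
    at-x = trans
      (sum-concentrated on x λ y y≢x → trans (cong (λ k → ι k * f y) (𝟙-false (y ≟ x) y≢x)) (*-zeroˡ (f y)))
      (trans (cong (λ k → ι k * f x) (𝟙-true (x ≟ x) refl)) (*-identityˡ (f x)))
    pointwise : ∀ y (d : Dec (y ≡ x)) → ι (𝟙 (¬? d)) * f y + ι (𝟙 d) * f y ≡ f y
    pointwise y (yes _) = trans (cong₂ _+_ (*-zeroˡ (f y)) (*-identityˡ (f y))) (+-identityˡ (f y))
    pointwise y (no _)  = trans (cong₂ _+_ (*-identityˡ (f y)) (*-zeroˡ (f y))) (+-identityʳ (f y))

  -- The sum over pairs of components

  module PairSum {N} (a b u : Fin N → ℚ) {m n m⁻¹ n⁻¹ : ℚ} (m-inv : m * m⁻¹ ≡ 1ℚ) (n-inv : n * n⁻¹ ≡ 1ℚ)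
    (∑a : sum a ≡ m) (∑b : sum b ≡ n) (u-inv : ∀ x → (n * a x + m * b x) * u x ≡ 1ℚ) where

    open ≡-Reasoning

    α : ℚ
    α = sum (λ x → a x * b x * u x)

    -- The factor by which merging components x and y turns ∏ d into ∏ d′ * (1 - α′).
    pair : Fin N → Fin N → ℚ
    pair x y = (u x + u y) * (1ℚ - α) + a x * b x * u x * u x + a y * b y * u y * u y
               - (a x * b y + a y * b x) * u x * u y

    private
      au bu aau bbu aabuu abbuu : Fin N → ℚ
      au x = a x * u x
      bu x = b x * u x
      aau x = a x * a x * u x
      bbu x = b x * b x * u x
      aabuu x = a x * a x * b x * u x * u x
      abbuu x = a x * b x * b x * u x * u x
      abu : Fin N → ℚ
      abu x = a x * b x * u x

      -- Since u = 1/d with d = n a + m b, a combination with this factor loses one `u`. Taking h =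
      -- 1, a, b and a b u gives the linear relations among the sums that occur in `full`.
      relation : ∀ f g h → (∀ x → n * f x + m * g x ≡ (n * a x + m * b x) * u x * h x) → n * sum f + m * sum g ≡ sum h
      relation f g h eq = trans (sum-linear n m f g) (sum-cong-≗ λ x →
        trans (eq x) (trans (cong (_* h x) (u-inv x)) (*-identityˡ (h x))))

      rel-1 : n * sum au + m * sum bu ≡ ι N
      rel-1 = trans (relation au bu (λ _ → 1ℚ) λ x → solve 5 (λ n m a b u →
        n :* (a :* u) :+ m :* (b :* u) := (n :* a :+ m :* b) :* u :* con 1ℚ) refl n m (a x) (b x) (u x)) (sum-replicate N)

      rel-a : n * sum aau + m * α ≡ m
      rel-a = trans (relation aau abu a λ x → solve 5 (λ n m a b u →
        n :* (a :* a :* u) :+ m :* (a :* b :* u) := (n :* a :+ m :* b) :* u :* a) refl n m (a x) (b x) (u x)) ∑a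

      rel-b : n * α + m * sum bbu ≡ n
      rel-b = trans (relation abu bbu b λ x → solve 5 (λ n m a b u →
        n :* (a :* b :* u) :+ m :* (b :* b :* u) := (n :* a :+ m :* b) :* u :* b) refl n m (a x) (b x) (u x)) ∑b

      rel-ab : n * sum aabuu + m * sum abbuu ≡ α
      rel-ab = relation aabuu abbuu abu λ x → solve 5 (λ n m a b u →
        n :* (a :* a :* b :* u :* u) :+ m :* (a :* b :* b :* u :* u) := (n :* a :+ m :* b) :* u :* (a :* b :* u)) refl n m (a x) (b x) (u x)

      -- `rel-a` and `rel-b` give n ∑ a²u = m (1 - α) and m ∑ b²u = n (1 - α); multiply and cancel m
      -- n. In matrix terms this is the singularity of the contracted Laplacian.
      squares : sum aau * sum bbu ≡ (1ℚ - α) * (1ℚ - α)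
      squares = *-cancelˡ-inverse n n⁻¹ n-inv (*-cancelˡ-inverse m m⁻¹ m-inv (begin
        m * (n * (sum aau * sum bbu))             ≡⟨ solve 5 (λ m n A B α →
          m :* (n :* (A :* B)) := (n :* A :+ m :* α :- m :* α) :* (n :* α :+ m :* B :- n :* α)) refl m n (sum aau) (sum bbu) α ⟩
        (n * sum aau + m * α - m * α) * (n * α + m * sum bbu - n * α)  ≡⟨ cong₂ (λ p q → (p - m * α) * (q - n * α)) rel-a rel-b ⟩
        (m - m * α) * (n - n * α)                 ≡⟨ solve 3 (λ m n α →
          (m :- m :* α) :* (n :- n :* α) := m :* (n :* ((con 1ℚ :- α) :* (con 1ℚ :- α)))) refl m n α ⟩
        m * (n * ((1ℚ - α) * (1ℚ - α)))           ∎))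

    private
      β : ℚ
      β = 1ℚ - α

      -- a_x b_y `pair x y` as four outer products: the terms with only `u x`, those with only
      -- `u y`, and the two mixed terms, whose minus sign is put into the right factor.
      fs gs : Fin 4 → Fin N → ℚ
      fs = (λ x → β * au x + 1ℚ * aabuu x) ∷ᶠ a ∷ᶠ aau ∷ᶠ abu ∷ᶠ λ ()
      gs = b ∷ᶠ (λ y → β * bu y + 1ℚ * abbuu y) ∷ᶠ (λ y → - 1ℚ * bbu y) ∷ᶠ (λ y → - 1ℚ * abu y) ∷ᶠ λ ()

      full : sum (λ x → sum (λ y → a x * b y * pair x y)) ≡ β * ι N + α - β * β - α * α
      full = begin
        sum (λ x → sum (λ y → a x * b y * pair x y))        ≡⟨ sum-cong-≗ (λ x → sum-cong-≗ (λ y → solve 7 (λ ax bx ux ay by uy β →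
            ax :* by :* ((ux :+ uy) :* β :+ ax :* bx :* ux :* ux :+ ay :* by :* uy :* uy :- (ax :* by :+ ay :* bx) :* ux :* uy)
            := (β :* (ax :* ux) :+ con 1ℚ :* (ax :* ax :* bx :* ux :* ux)) :* by
               :+ (ax :* (β :* (by :* uy) :+ con 1ℚ :* (ay :* by :* by :* uy :* uy))
               :+ (ax :* ax :* ux :* (con (- 1ℚ) :* (by :* by :* uy))
               :+ (ax :* bx :* ux :* (con (- 1ℚ) :* (ay :* by :* uy)) :+ con 0ℚ))))
            refl (a x) (b x) (u x) (a y) (b y) (u y) β)) ⟩
        sum (λ x → sum (λ y → sum (λ r → fs r x * gs r y))) ≡⟨ sum-rank fs gs ⟩
        sum (λ x → β * au x + 1ℚ * aabuu x) * sum b + (sum a * sum (λ y → β * bu y + 1ℚ * abbuu y)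
          + (sum aau * sum (λ y → - 1ℚ * bbu y) + (α * sum (λ y → - 1ℚ * abu y) + 0ℚ)))
          ≡⟨ cong₂ _+_ (cong₂ _*_ (sym (sum-linear β 1ℚ au aabuu)) ∑b)
            (cong₂ _+_ (cong₂ _*_ ∑a (sym (sum-linear β 1ℚ bu abbuu)))
            (cong₂ (λ p q → sum aau * p + (α * q + 0ℚ)) (sym (*-distribˡ-sum (- 1ℚ) bbu)) (sym (*-distribˡ-sum (- 1ℚ) abu)))) ⟩
        (β * sum au + 1ℚ * sum aabuu) * n + (m * (β * sum bu + 1ℚ * sum abbuu)
          + (sum aau * (- 1ℚ * sum bbu) + (α * (- 1ℚ * α) + 0ℚ)))
          ≡⟨ solve 10 (λ β A C n m B D A₂ B₂ α →
               (β :* A :+ con 1ℚ :* C) :* n :+ (m :* (β :* B :+ con 1ℚ :* D) :+ (A₂ :* (con (- 1ℚ) :* B₂) :+ (α :* (con (- 1ℚ) :* α) :+ con 0ℚ)))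
               := β :* (n :* A :+ m :* B) :+ (n :* C :+ m :* D) :- A₂ :* B₂ :- α :* α)
               refl β (sum au) (sum aabuu) n m (sum bu) (sum abbuu) (sum aau) (sum bbu) α ⟩
        β * (n * sum au + m * sum bu) + (n * sum aabuu + m * sum abbuu) - sum aau * sum bbu - α * α
          ≡⟨ cong₂ (λ p q → p - q - α * α) (cong₂ (λ p q → β * p + q) rel-1 rel-ab) squares ⟩
        β * ι N + α - β * β - α * α ∎

      -- At x = y the terms in u² cancel and `pair x x` is 2 u (1 - α).
      diagonal : sum (λ x → a x * b x * pair x x) ≡ β * α + β * α
      diagonal = trans (sum-cong-≗ (λ x → solve 4 (λ a b u β →
          a :* b :* ((u :+ u) :* β :+ a :* b :* u :* u :+ a :* b :* u :* u :- (a :* b :+ a :* b) :* u :* u)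
          := β :* (a :* b :* u) :+ β :* (a :* b :* u)) refl (a x) (b x) (u x) β))
        (sym (sum-linear β β abu abu))

    -- Subtracting the diagonal leaves β N + α - (α + β)², and α + β = 1 turns this into β N - β.
    off-diagonal : sum (λ x → a x * sum (λ y → b y * (ι (𝟙 (¬? (y ≟ x))) * pair x y))) ≡ (ι N - 1ℚ) * (1ℚ - α)
    off-diagonal = begin
      sum off                                      ≡⟨ solve 2 (λ p q → p := p :+ q :- q) refl (sum off) (sum diag) ⟩
      sum off + sum diag - sum diag                ≡⟨ cong₂ _-_ (trans (sym (∑-distrib-+ off diag)) (sum-cong-≗ row)) diagonal ⟩
      sum (λ x → sum (λ y → a x * b y * pair x y)) - (β * α + β * α)  ≡⟨ cong (_- (β * α + β * α)) full ⟩
      β * ι N + α - β * β - α * α - (β * α + β * α) ≡⟨ solve 2 (λ N α → let β = con 1ℚ :- α in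
          β :* N :+ α :- β :* β :- α :* α :- (β :* α :+ β :* α) := (N :- con 1ℚ) :* β) refl (ι N) α ⟩
      (ι N - 1ℚ) * (1ℚ - α)                        ∎
      where
      off diag : Fin N → ℚ
      off x = a x * sum (λ y → b y * (ι (𝟙 (¬? (y ≟ x))) * pair x y))
      diag x = a x * b x * pair x x
      row : ∀ x → off x + diag x ≡ sum (λ y → a x * b y * pair x y)
      row x = trans (cong (_+ diag x) (trans (*-distribˡ-sum (a x) (λ y → b y * (ι (𝟙 (¬? (y ≟ x))) * pair x y)))
          (sum-cong-≗ λ y → solve 4 (λ a b i p → a :* (b :* (i :* p)) := i :* (a :* b :* p)) refl (a x) (b y) (ι (𝟙 (¬? (y ≟ x)))) (pair x y))))
        (sum-off-diagonal (λ y → a x * b y * pair x y) x)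

  -- The weight of a labelling and its change under merging

  module Weight (m n : ℕ) .{{_ : ℕ.NonZero m}} .{{_ : ℕ.NonZero n}} where

    open ≡-Reasoning

    lefts rights degree : (Vertex m n → Fin N) → Fin N → ℕ
    lefts c  = fibre (c ∘ inj₁)
    rights c = fibre (c ∘ inj₂)
    degree c x = n ℕ.* lefts c x ℕ.+ m ℕ.* rights c x

    α : (Vertex m n → Fin N) → ℚ
    α c = sum (λ x → ι (lefts c x) * ι (rights c x) * ι⁻¹ (degree c x))

    degrees : (Vertex m n → Fin N) → ℚ
    degrees c = prod (λ x → ι (degree c x))

    ι-degree : ∀ (c : Vertex m n → Fin N) x → ι (degree c x) ≡ ι n * ι (lefts c x) + ι m * ι (rights c x)
    ι-degree c x = trans (ι-+ (n ℕ.* lefts c x) _) (cong₂ _+_ (ι-* n (lefts c x)) (ι-* m (rights c x)))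

    degree-inverse : ∀ (c : Vertex m n → Fin N) x → (∃ λ v → c v ≡ x) → ι (degree c x) * ι⁻¹ (degree c x) ≡ 1ℚ
    degree-inverse c x (inj₁ i , refl) = ι-inverse (degree c x) {{ℕ.≢-nonZero λ deg≡0 →
      let k , a≡ = fibre-nonempty (c ∘ inj₁) i
      in ℕ.≢-nonZero⁻¹ (n ℕ.* suc k) {{ℕ.m*n≢0 n (suc k)}}
           (trans (cong (n ℕ.*_) (sym a≡)) (ℕ.m+n≡0⇒m≡0 _ deg≡0))}}
    degree-inverse c x (inj₂ j , refl) = ι-inverse (degree c x) {{ℕ.≢-nonZero λ deg≡0 →
      let k , b≡ = fibre-nonempty (c ∘ inj₂) j
      in ℕ.≢-nonZero⁻¹ (m ℕ.* suc k) {{ℕ.m*n≢0 m (suc k)}}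
           (trans (cong (m ℕ.*_) (sym b≡)) (ℕ.m+n≡0⇒n≡0 (n ℕ.* lefts c x) deg≡0))}}

    module Merge (c : Vertex m n → Fin (suc N)) (surjective : ∀ x → ∃ λ v → c v ≡ x) (y : Fin (suc N)) (x′ : Fin N) where

      c′ : Vertex m n → Fin N
      c′ = merge y x′ ∘ c

      private
        x : Fin (suc N)
        x = punchIn y x′

        a b d u p : Fin (suc N) → ℚ
        a z = ι (lefts c z)
        b z = ι (rights c z)
        d z = ι (degree c z)
        u z = ι⁻¹ (degree c z)
        p z = a z * b z * u z

        d′ p′ : Fin N → ℚ
        d′ z = ι (degree c′ z)
        p′ z = ι (lefts c′ z) * ι (rights c′ z) * ι⁻¹ (degree c′ z)

        a′-merged : ι (lefts c′ x′) ≡ a x + a y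
        a′-merged = trans (cong ι (fibre-merge-same (c ∘ inj₁) y x′)) (ι-+ (lefts c x) _)

        b′-merged : ι (rights c′ x′) ≡ b x + b y
        b′-merged = trans (cong ι (fibre-merge-same (c ∘ inj₂) y x′)) (ι-+ (rights c x) _)

        degree-other : ∀ z → z ≢ x′ → degree c′ z ≡ degree c (punchIn y z)
        degree-other z z≢ = cong₂ (λ j k → n ℕ.* j ℕ.+ m ℕ.* k)
          (fibre-merge-other (c ∘ inj₁) y x′ z z≢) (fibre-merge-other (c ∘ inj₂) y x′ z z≢)

        p-other : ∀ z → z ≢ x′ → p′ z ≡ p (punchIn y z)
        p-other z z≢ = cong₂ _*_ (cong₂ (λ j k → ι j * ι k)
          (fibre-merge-other (c ∘ inj₁) y x′ z z≢) (fibre-merge-other (c ∘ inj₂) y x′ z z≢)) (cong ι⁻¹ (degree-other z z≢))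

      degree-merged : d′ x′ ≡ d x + d y
      degree-merged = begin
        d′ x′                                            ≡⟨ ι-degree c′ x′ ⟩
        ι n * ι (lefts c′ x′) + ι m * ι (rights c′ x′)   ≡⟨ cong₂ (λ s t → ι n * s + ι m * t) a′-merged b′-merged ⟩
        ι n * (a x + a y) + ι m * (b x + b y)            ≡⟨ solve 6 (λ n m a b a′ b′ →
          n :* (a :+ a′) :+ m :* (b :+ b′) := (n :* a :+ m :* b) :+ (n :* a′ :+ m :* b′)) refl (ι n) (ι m) (a x) (b x) (a y) (b y) ⟩
        (ι n * a x + ι m * b x) + (ι n * a y + ι m * b y) ≡⟨ cong₂ _+_ (ι-degree c x) (ι-degree c y) ⟨
        d x + d y                                        ∎

      merged-inverse : (d x + d y) * ι⁻¹ (degree c′ x′) ≡ 1ℚ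
      merged-inverse = trans (cong (_* ι⁻¹ (degree c′ x′)) (sym degree-merged)) (degree-inverse c′ x′
        (let v , cv≡ = surjective x in v , trans (cong (merge y x′) cv≡) (merge-punchIn y x′ x′)))

      -- Off `x′` the new degrees agree with those of `c` along `punchIn y`; so the change is one
      -- update at `x′` and the removal of `y`. The quotient (d x + d y) / (d x d y) is cleared of
      -- fractions.
      degrees-merge : degrees c′ * (d x * d y) ≡ degrees c * (d x + d y)
      degrees-merge = begin
        degrees c′ * (d x * d y)                    ≡⟨ *-assoc (degrees c′) (d x) (d y) ⟨
        degrees c′ * d x * d y                      ≡⟨ cong (_* d y) (prod-update d′ (d ∘ punchIn y) x′ λ z z≢ → cong ι (degree-other z z≢)) ⟩
        prod (d ∘ punchIn y) * d′ x′ * d y          ≡⟨ cong (λ t → prod (d ∘ punchIn y) * t * d y) degree-merged ⟩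
        prod (d ∘ punchIn y) * (d x + d y) * d y    ≡⟨ solve 3 (λ p s t → p :* s :* t := t :* p :* s) refl (prod (d ∘ punchIn y)) (d x + d y) (d y) ⟩
        d y * prod (d ∘ punchIn y) * (d x + d y)    ≡⟨ cong (_* (d x + d y)) (prod-remove {i = y} d) ⟨
        degrees c * (d x + d y)                     ∎

      α-merge : α c′ + (p x + p y) ≡ α c + (a x + a y) * (b x + b y) * ι⁻¹ (degree c′ x′)
      α-merge = begin
        α c′ + (p x + p y)                   ≡⟨ solve 3 (λ s t r → s :+ (t :+ r) := (s :+ t) :+ r) refl (α c′) (p x) (p y) ⟩
        α c′ + p x + p y                     ≡⟨ cong (_+ p y) (sum-update p′ (p ∘ punchIn y) x′ p-other) ⟩
        sum (p ∘ punchIn y) + p′ x′ + p y    ≡⟨ solve 3 (λ s t r → s :+ t :+ r := (r :+ s) :+ t) refl (sum (p ∘ punchIn y)) (p′ x′) (p y) ⟩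
        p y + sum (p ∘ punchIn y) + p′ x′    ≡⟨ cong₂ _+_ (sym (sum-remove {i = y} p)) (cong (_* ι⁻¹ (degree c′ x′)) (cong₂ _*_ a′-merged b′-merged)) ⟩
        α c + (a x + a y) * (b x + b y) * ι⁻¹ (degree c′ x′) ∎

      weight-merge : degrees c′ * (1ℚ - α c′) ≡ degrees c *
        ((u x + u y) * (1ℚ - α c) + a x * b x * u x * u x + a y * b y * u y * u y - (a x * b y + a y * b x) * u x * u y)
      weight-merge = begin
        P′ * (1ℚ - α c′)
          -- Two factors 1 are inserted to become d u at `x` and at `y`; the d's then meet
          -- `degrees c′` as `degrees-merge` requires.
          ≡⟨ solve 2 (λ P r → P :* r := P :* con 1ℚ :* con 1ℚ :* r) refl P′ (1ℚ - α c′) ⟩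
        P′ * 1ℚ * 1ℚ * (1ℚ - α c′)
          ≡⟨ cong₂ (λ s t → P′ * s * t * (1ℚ - α c′)) (d-inv x) (d-inv y) ⟨
        P′ * (d x * u x) * (d y * u y) * (1ℚ - α c′)
          ≡⟨ solve 8 (λ P dx ux dy uy α′ px py →
               P :* (dx :* ux) :* (dy :* uy) :* (con 1ℚ :- α′) := P :* (dx :* dy) :* ux :* uy :* (con 1ℚ :- (α′ :+ (px :+ py)) :+ px :+ py))
               refl P′ (d x) (u x) (d y) (u y) (α c′) (p x) (p y) ⟩
        P′ * (d x * d y) * u x * u y * (1ℚ - (α c′ + (p x + p y)) + p x + p y)
          ≡⟨ cong₂ (λ s t → s * u x * u y * (1ℚ - t + p x + p y)) degrees-merge α-merge ⟩
        P * (d x + d y) * u x * u y * (1ℚ - (α c + (a x + a y) * (b x + b y) * u′) + p x + p y)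
          -- The expression is arranged so that every d occurs in d x u x, d y u y or (d x + d y)
          -- u′, each of which is 1.
          ≡⟨ solve 11 (λ P dx dy ux uy α ax bx ay by u′ →
               P :* (dx :+ dy) :* ux :* uy :* (con 1ℚ :- (α :+ (ax :+ ay) :* (bx :+ by) :* u′) :+ ax :* bx :* ux :+ ay :* by :* uy)
               := P :* ((dx :* ux :* uy :+ dy :* uy :* ux) :* (con 1ℚ :- α :+ ax :* bx :* ux :+ ay :* by :* uy)
                        :- (dx :+ dy) :* u′ :* ((ax :+ ay) :* (bx :+ by) :* ux :* uy)))
               refl P (d x) (d y) (u x) (u y) (α c) (a x) (b x) (a y) (b y) u′ ⟩
        P * ((d x * u x * u y + d y * u y * u x) * (1ℚ - α c + p x + p y)
             - (d x + d y) * u′ * ((a x + a y) * (b x + b y) * u x * u y))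
          ≡⟨ cong₂ (λ s t → P * (s * (1ℚ - α c + p x + p y) - t * ((a x + a y) * (b x + b y) * u x * u y)))
               (cong₂ (λ s t → s * u y + t * u x) (d-inv x) (d-inv y)) merged-inverse ⟩
        P * ((1ℚ * u y + 1ℚ * u x) * (1ℚ - α c + p x + p y) - 1ℚ * ((a x + a y) * (b x + b y) * u x * u y))
          ≡⟨ solve 8 (λ P ux uy α ax bx ay by →
               P :* ((con 1ℚ :* uy :+ con 1ℚ :* ux) :* (con 1ℚ :- α :+ ax :* bx :* ux :+ ay :* by :* uy)
                     :- con 1ℚ :* ((ax :+ ay) :* (bx :+ by) :* ux :* uy))
               := P :* ((ux :+ uy) :* (con 1ℚ :- α) :+ ax :* bx :* ux :* ux :+ ay :* by :* uy :* uy :- (ax :* by :+ ay :* bx) :* ux :* uy))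
               refl P (u x) (u y) (α c) (a x) (b x) (a y) (b y) ⟩
        P * ((u x + u y) * (1ℚ - α c) + a x * b x * u x * u x + a y * b y * u y * u y - (a x * b y + a y * b x) * u x * u y) ∎
        where
        P P′ u′ : ℚ
        P = degrees c
        P′ = degrees c′
        u′ = ι⁻¹ (degree c′ x′)
        d-inv : ∀ z → d z * u z ≡ 1ℚ
        d-inv z = degree-inverse c z (surjective z)

    -- The number of trees containing a forest

    module TreeFormula {Q : EdgeSet m n → Set} (Q? : Decidable Q) {F₀ : EdgeSet m n}
      (Q⇒tree : ∀ {S} → Q S → IsSpanningTree S) (tree⇒Q : ∀ {S} → IsSpanningTree S → F₀ ⊆ S → Q S) where

      open TreeCount Q? {F₀} Q⇒tree tree⇒Q

      tree-formula : ∀ {F} {c : Vertex m n → Fin (suc N)} → F₀ ⊆ F → IsForest F c →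
        ι m * ι n * ι (trees F) ≡ degrees c * (1ℚ - α c)
      -- A single component has a = m, b = n and d = 2 m n, so d (1 - a b / d) = d - a b = m n.
      tree-formula {N = zero} {F} {c} F₀⊆F forest = begin
        ι m * ι n * ι (trees F)              ≡⟨ cong (λ t → ι m * ι n * ι t) (trees-spanning F₀⊆F forest) ⟩
        ι m * ι n * 1ℚ                       ≡⟨ cong₂ (λ s t → s * t * 1ℚ) m≡a n≡b ⟩
        a * b * 1ℚ                           ≡⟨ solve 2 (λ a b → a :* b :* con 1ℚ := b :* a :+ a :* b :- con 1ℚ :* (a :* b)) refl a b ⟩
        b * a + a * b - 1ℚ * (a * b)         ≡⟨ cong₂ (λ s t → s - t * (a * b)) d≡ (sym (degree-inverse c zero (surjective zero))) ⟩
        d - d * u * (a * b)                  ≡⟨ solve 4 (λ a b d u →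
          d :- d :* u :* (a :* b) := d :* con 1ℚ :* (con 1ℚ :- (a :* b :* u :+ con 0ℚ))) refl a b d u ⟩
        degrees c * (1ℚ - α c)               ∎
        where
        open IsForest forest
        a b d u : ℚ
        a = ι (lefts c zero)
        b = ι (rights c zero)
        d = ι (degree c zero)
        u = ι⁻¹ (degree c zero)
        m≡a : ι m ≡ a
        m≡a = trans (sym (sum-fibre (c ∘ inj₁))) (+-identityʳ a)
        n≡b : ι n ≡ b
        n≡b = trans (sym (sum-fibre (c ∘ inj₂))) (+-identityʳ b)
        d≡ : b * a + a * b ≡ d
        d≡ = trans (cong₂ (λ s t → s * a + t * b) (sym n≡b) (sym m≡a)) (sym (ι-degree c zero))
      -- Here there are N + 2 components, so the recurrence carries the factor N + 1, which is
      -- non-zero and is cancelled.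
      tree-formula {N = suc N} {F} {c} F₀⊆F forest = ι-cancelˡ (suc N) (begin
        ι (suc N) * (ι m * ι n * ι (trees F))
          ≡⟨ solve 4 (λ N m n t → N :* (m :* n :* t) := m :* n :* (N :* t)) refl (ι (suc N)) (ι m) (ι n) (ι (trees F)) ⟩
        mn * (ι (suc N) * ι (trees F))
          ≡⟨ cong (mn *_) (trans (sym (ι-* (suc N) (trees F))) (cong ι (trees-recurrence forest))) ⟩
        mn * ι (∑₂ term)
          ≡⟨ cong (mn *_) (trans (ι-sum (λ i → ℕSum.sum (term i))) (sum-cong-≗ λ i → ι-sum (term i))) ⟩
        mn * sum (λ i → sum (λ j → ι (term i j)))
          ≡⟨ trans (*-distribˡ-sum mn (λ i → sum (λ j → ι (term i j)))) (sum-cong-≗ λ i → *-distribˡ-sum mn (λ j → ι (term i j))) ⟩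
        sum (λ i → sum (λ j → mn * ι (term i j)))
          ≡⟨ sum-cong-≗ (λ i → sum-cong-≗ (λ j → crossing i j (c (inj₂ j) ≟ c (inj₁ i)))) ⟩
        sum (λ i → sum (λ j → P * offPair (c (inj₁ i)) (c (inj₂ j))))
          ≡⟨ sum-cong-≗ (λ i → sym (*-distribˡ-sum P (λ j → offPair (c (inj₁ i)) (c (inj₂ j))))) ⟩
        sum (λ i → P * sum (λ j → offPair (c (inj₁ i)) (c (inj₂ j))))
          ≡⟨ *-distribˡ-sum P (λ i → sum (λ j → offPair (c (inj₁ i)) (c (inj₂ j)))) ⟨
        P * sum (λ i → sum (λ j → offPair (c (inj₁ i)) (c (inj₂ j))))
          -- The term of an edge depends only on the labels of its ends, so the sum over vertices
          -- becomes one over components with weights a_x b_y.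
          ≡⟨ cong (P *_) (sum-cong-≗ λ i → sum-fibres (c ∘ inj₂) (offPair (c (inj₁ i)))) ⟩
        P * sum (λ i → sum (λ y → ι (rights c y) * offPair (c (inj₁ i)) y))
          ≡⟨ cong (P *_) (sum-fibres (c ∘ inj₁) (λ x → sum (λ y → ι (rights c y) * offPair x y))) ⟩
        P * sum (λ x → ι (lefts c x) * sum (λ y → ι (rights c y) * offPair x y))
          ≡⟨ cong (P *_) off-diagonal ⟩
        P * ((ι (suc (suc N)) - 1ℚ) * (1ℚ - α c))
          ≡⟨ solve 3 (λ P N α → P :* ((con 1ℚ :+ N :- con 1ℚ) :* (con 1ℚ :- α)) := N :* (P :* (con 1ℚ :- α))) refl P (ι (suc N)) (α c) ⟩
        ι (suc N) * (P * (1ℚ - α c)) ∎)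
        where
        open IsForest forest
        open PairSum (ι ∘ lefts c) (ι ∘ rights c) (ι⁻¹ ∘ degree c) (ι-inverse m) (ι-inverse n)
          (sum-fibre (c ∘ inj₁)) (sum-fibre (c ∘ inj₂))
          (λ x → trans (cong (_* ι⁻¹ (degree c x)) (sym (ι-degree c x))) (degree-inverse c x (surjective x)))
          hiding (α)
        mn P : ℚ
        mn = ι m * ι n
        P = degrees c
        term : Fin m → Fin n → ℕ
        term i j = 𝟙 (crosses? c i j) ℕ.* trees (addEdge F i j)
        offPair : Fin (suc (suc N)) → Fin (suc (suc N)) → ℚ
        offPair x y = ι (𝟙 (¬? (y ≟ x))) * pair x y
        crossing : ∀ i j (d : Dec (c (inj₂ j) ≡ c (inj₁ i))) →
          mn * ι (𝟙 (¬? d) ℕ.* trees (addEdge F i j)) ≡ P * (ι (𝟙 (¬? d)) * pair (c (inj₁ i)) (c (inj₂ j)))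
        crossing i j (yes _) = trans (*-zeroʳ mn) (sym (trans (cong (P *_) (*-zeroˡ (pair (c (inj₁ i)) (c (inj₂ j))))) (*-zeroʳ P)))
        crossing i j (no cj≢ci) = begin
          mn * ι (1 ℕ.* trees (addEdge F i j))     ≡⟨ cong (λ t → mn * ι t) (ℕ.*-identityˡ (trees (addEdge F i j))) ⟩
          mn * ι (trees (addEdge F i j))           ≡⟨ tree-formula (λ i′ j′ → addEdge-old F i j i′ j′ ∘ F₀⊆F i′ j′) (addCrossing-forest forest cj≢ci) ⟩
          degrees c′ * (1ℚ - α c′)                 ≡⟨ weight-merge ⟩
          P * pair (punchIn y x′) y                ≡⟨ cong (λ x → P * pair x y) (punchIn-punchOut cj≢ci) ⟩
          P * pair (c (inj₁ i)) y                  ≡⟨ cong (P *_) (*-identityˡ (pair (c (inj₁ i)) y)) ⟨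
          P * (1ℚ * pair (c (inj₁ i)) y)           ∎
          where
          y = c (inj₂ j)
          x′ = punchOut cj≢ci
          open Merge c surjective y x′ using (c′; weight-merge)

    -- The forest formed by a matching

    discrete : Vertex m n → Fin (m ℕ.+ n)
    discrete = join m n

    discrete-injective : ∀ {u v} → discrete u ≡ discrete v → u ≡ v
    discrete-injective {u} {v} eq = trans (sym (splitAt-join m n u)) (trans (cong (splitAt m) eq) (splitAt-join m n v))

    discrete-forest : IsForest (λ _ _ → false) discrete
    discrete-forest = record
      { surjective = λ x → splitAt m x , join-splitAt m n x
      ; sound = λ ()
      ; complete = λ eq → subst (Reachable _ _) (discrete-injective eq) ε
      ; bridges = λ { (inj₁ _) (inj₂ _) () ; (inj₂ _) (inj₁ _) () }
      }

    -- A one-vertex component lies on one side. Grouping by left vertices leaves only labels without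
    -- right vertices.
    α-discrete : α discrete ≡ 0ℚ
    α-discrete = begin
      α discrete                                          ≡⟨ sum-cong-≗ (λ x → *-assoc (ι (lefts discrete x)) _ _) ⟩
      sum (λ x → ι (lefts discrete x) * bu x)             ≡⟨ sum-fibres (discrete ∘ inj₁) bu ⟨
      sum (λ i → bu (discrete (inj₁ i)))                  ≡⟨ sum-cong-≗ (λ i → trans
        (cong (λ k → ι k * ι⁻¹ (degree discrete (discrete (inj₁ i)))) (fibre-empty (discrete ∘ inj₂) _ λ j eq → inj₂≢inj₁ (discrete-injective eq)))
        (*-zeroˡ (ι⁻¹ (degree discrete (discrete (inj₁ i)))))) ⟩
      sum {m} (λ _ → 0ℚ)                                  ≡⟨ sum-replicate-zero m ⟩
      0ℚ                                                  ∎
      where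
      bu : Fin (m ℕ.+ n) → ℚ
      bu x = ι (rights discrete x) * ι⁻¹ (degree discrete x)

    -- The invariant for adding matching edges one at a time. Isolation of unmatched vertices fixes
    -- the types of the two components that the next edge joins. `components` is a field tied to `k`
    -- by an addition, which keeps truncated subtraction out of the type of labels.
    record MatchingForest {k} (M : Matching k m n) : Set where
      field
        components    : ℕ
        components+k  : components ℕ.+ k ≡ m ℕ.+ n
        edges         : EdgeSet m n
        label         : Vertex m n → Fin components
        forest        : IsForest edges label
        matched-edge  : ∀ a → edges (left M a) (right M a) ≡ true
        edge-matched  : ∀ i j → edges i j ≡ true → ∃ λ a → left M a ≡ i × right M a ≡ j
        left-isolated  : ∀ i → (∀ a → left M a ≢ i) → ∀ v → label v ≡ label (inj₁ i) → v ≡ inj₁ i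
        right-isolated : ∀ j → (∀ a → right M a ≢ j) → ∀ v → label v ≡ label (inj₂ j) → v ≡ inj₂ j
        degrees-label : degrees label * ι ((m ℕ.* n) ℕ.^ k) ≡ degrees discrete * ι ((m ℕ.+ n) ℕ.^ k)
        α-label       : ι (m ℕ.+ n) * α label ≡ ι k

    dropFirst : ∀ {k} → Matching (suc k) m n → Matching k m n
    dropFirst M = record
      { left = left M ∘ suc ; right = right M ∘ suc
      ; left-inj = suc-injective ∘ left-inj M ; right-inj = suc-injective ∘ right-inj M }

    empty-matchingForest : (M : Matching 0 m n) → MatchingForest M
    empty-matchingForest M = record
      { components = m ℕ.+ n
      ; components+k = ℕ.+-identityʳ (m ℕ.+ n)
      ; edges = λ _ _ → false
      ; label = discrete
      ; forest = discrete-forest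
      ; matched-edge = λ ()
      ; edge-matched = λ _ _ ()
      ; left-isolated = λ _ _ _ → discrete-injective
      ; right-isolated = λ _ _ _ → discrete-injective
      ; degrees-label = refl
      ; α-label = trans (cong (ι (m ℕ.+ n) *_) α-discrete) (*-zeroʳ (ι (m ℕ.+ n)))
      }

    -- By injectivity the ends of the added edge are still isolated, with types (1,0) and (0,1) and
    -- degrees n and m. Merging them multiplies ∏ d by (m + n) / (m n) and raises α by 1 / (m + n).
    extend-matchingForest : ∀ {k} (M : Matching (suc k) m n) (mf : MatchingForest (dropFirst M)) → MatchingForest M
    extend-matchingForest {k} M record { components = zero ; label = c } = case c (inj₁ (left M zero)) of λ ()
    extend-matchingForest {k} M record
      { components = suc N ; components+k = N+k ; edges = F ; label = c ; forest = forest
      ; matched-edge = matched ; edge-matched = edge-matched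
      ; left-isolated = left-isolated ; right-isolated = right-isolated
      ; degrees-label = degrees-c ; α-label = α-c } = record
      { components = N
      ; components+k = trans (ℕ.+-suc N k) N+k
      ; edges = addEdge F i j
      ; label = c′
      ; forest = addCrossing-forest forest cj≢ci
      ; matched-edge = λ { zero → addEdge-new F i j ; (suc a) → addEdge-old F i j _ _ (matched a) }
      ; edge-matched = edge-matched′
      ; left-isolated = λ i′ unmatched v eq → isolated (left-isolated i′ (unmatched ∘ suc))
          (λ eq → unmatched zero (inj₁-injective (left-isolated i′ (unmatched ∘ suc) (inj₁ i) eq)))
          (λ eq → inj₂≢inj₁ (left-isolated i′ (unmatched ∘ suc) (inj₂ j) eq)) v eq
      ; right-isolated = λ j′ unmatched v eq → isolated (right-isolated j′ (unmatched ∘ suc))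
          (λ eq → inj₂≢inj₁ (sym (right-isolated j′ (unmatched ∘ suc) (inj₁ i) eq)))
          (λ eq → unmatched zero (inj₂-injective (right-isolated j′ (unmatched ∘ suc) (inj₂ j) eq))) v eq
      ; degrees-label = degrees-c′
      ; α-label = α-c′
      }
      where
      open IsForest forest using (surjective)
      i = left M zero
      j = right M zero
      i-isolated : ∀ v → c v ≡ c (inj₁ i) → v ≡ inj₁ i
      i-isolated = left-isolated i (λ a eq → 0≢1+n (sym (left-inj M eq)))
      j-isolated : ∀ v → c v ≡ c (inj₂ j) → v ≡ inj₂ j
      j-isolated = right-isolated j (λ a eq → 0≢1+n (sym (right-inj M eq)))
      cj≢ci : c (inj₂ j) ≢ c (inj₁ i)
      cj≢ci eq = inj₂≢inj₁ (i-isolated (inj₂ j) eq)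
      y = c (inj₂ j)
      x′ = punchOut cj≢ci
      x = punchIn y x′
      x≡ci : x ≡ c (inj₁ i)
      x≡ci = punchIn-punchOut cj≢ci
      open Merge c surjective y x′

      edge-matched′ : ∀ i′ j′ → addEdge F i j i′ j′ ≡ true → ∃ λ a → left M a ≡ i′ × right M a ≡ j′
      edge-matched′ i′ j′ e with addEdge-sound F i j i′ j′ e
      ... | inj₁ f  = let a , eqs = edge-matched i′ j′ f in suc a , eqs
      ... | inj₂ eq = zero , eq

      isolated : ∀ {w} → (∀ v → c v ≡ c w → v ≡ w) → c (inj₁ i) ≢ c w → c (inj₂ j) ≢ c w → ∀ v → c′ v ≡ c′ w → v ≡ w
      isolated {w} alone ci≢cw cj≢cw v eq with merge-kernel y x′ (c v) (c w) eq
      ... | inj₁ cv≡cw               = alone v cv≡cw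
      ... | inj₂ (inj₁ (_ , cw≡y))   = contradiction (sym cw≡y) cj≢cw
      ... | inj₂ (inj₂ (_ , cw≡x))   = contradiction (sym (trans cw≡x x≡ci)) ci≢cw

      lefts-x : lefts c x ≡ 1
      lefts-x = trans (cong (lefts c) x≡ci) (fibre-singleton (c ∘ inj₁) i λ i′ → inj₁-injective ∘ i-isolated (inj₁ i′))
      rights-x : rights c x ≡ 0
      rights-x = trans (cong (rights c) x≡ci) (fibre-empty (c ∘ inj₂) _ λ j′ → inj₂≢inj₁ ∘ i-isolated (inj₂ j′))
      lefts-y : lefts c y ≡ 0
      lefts-y = fibre-empty (c ∘ inj₁) _ λ i′ → inj₂≢inj₁ ∘ sym ∘ j-isolated (inj₁ i′)
      rights-y : rights c y ≡ 1
      rights-y = fibre-singleton (c ∘ inj₂) j λ j′ → inj₂-injective ∘ j-isolated (inj₂ j′)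

      degree-x : ι (degree c x) ≡ ι n
      degree-x = cong ι (trans (cong₂ (λ s t → n ℕ.* s ℕ.+ m ℕ.* t) lefts-x rights-x)
        (trans (cong₂ ℕ._+_ (ℕ.*-identityʳ n) (ℕ.*-zeroʳ m)) (ℕ.+-identityʳ n)))
      degree-y : ι (degree c y) ≡ ι m
      degree-y = cong ι (trans (cong₂ (λ s t → n ℕ.* s ℕ.+ m ℕ.* t) lefts-y rights-y)
        (cong₂ ℕ._+_ (ℕ.*-zeroʳ n) (ℕ.*-identityʳ m)))
      degree-sum : ι (degree c x) + ι (degree c y) ≡ ι (m ℕ.+ n)
      degree-sum = trans (cong₂ _+_ degree-x degree-y) (trans (+-comm (ι n) (ι m)) (sym (ι-+ m n)))

      degrees-c′ : degrees c′ * ι ((m ℕ.* n) ℕ.^ suc k) ≡ degrees discrete * ι ((m ℕ.+ n) ℕ.^ suc k)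
      degrees-c′ = begin
        degrees c′ * ι (m ℕ.* n ℕ.* (m ℕ.* n) ℕ.^ k)
          ≡⟨ cong (degrees c′ *_) (trans (ι-* (m ℕ.* n) _) (cong (_* pow) (trans (ι-* m n) (*-comm (ι m) (ι n))))) ⟩
        degrees c′ * (ι n * ι m * pow)
          ≡⟨ *-assoc (degrees c′) (ι n * ι m) pow ⟨
        degrees c′ * (ι n * ι m) * pow
          ≡⟨ cong₂ (λ s t → degrees c′ * (s * t) * pow) degree-x degree-y ⟨
        degrees c′ * (ι (degree c x) * ι (degree c y)) * pow
          ≡⟨ cong (_* pow) (trans degrees-merge (cong (degrees c *_) degree-sum)) ⟩
        degrees c * ι (m ℕ.+ n) * pow
          ≡⟨ solve 3 (λ s t r → s :* t :* r := t :* (s :* r)) refl (degrees c) (ι (m ℕ.+ n)) pow ⟩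
        ι (m ℕ.+ n) * (degrees c * pow)
          ≡⟨ cong (ι (m ℕ.+ n) *_) degrees-c ⟩
        ι (m ℕ.+ n) * (degrees discrete * ι ((m ℕ.+ n) ℕ.^ k))
          ≡⟨ solve 3 (λ s t r → t :* (s :* r) := s :* (t :* r)) refl (degrees discrete) (ι (m ℕ.+ n)) (ι ((m ℕ.+ n) ℕ.^ k)) ⟩
        degrees discrete * (ι (m ℕ.+ n) * ι ((m ℕ.+ n) ℕ.^ k))
          ≡⟨ cong (degrees discrete *_) (ι-* (m ℕ.+ n) _) ⟨
        degrees discrete * ι ((m ℕ.+ n) ℕ.^ suc k) ∎
        where
        pow = ι ((m ℕ.* n) ℕ.^ k)

      α-c′ : ι (m ℕ.+ n) * α c′ ≡ ι (suc k)
      α-c′ = begin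
        ι (m ℕ.+ n) * α c′
          -- Neither isolated end contributes to α; their zero contributions are written out to
          -- match the left side of `α-merge`.
          ≡⟨ cong (ι (m ℕ.+ n) *_) (solve 3 (λ α s t → α := α :+ (con 1ℚ :* con 0ℚ :* s :+ con 0ℚ :* con 1ℚ :* t)) refl (α c′) (u x) (u y)) ⟩
        ι (m ℕ.+ n) * (α c′ + (ι 1 * ι 0 * u x + ι 0 * ι 1 * u y))
          ≡⟨ cong (λ s → ι (m ℕ.+ n) * (α c′ + s)) (cong₂ _+_ (cong₂ (λ s t → ι s * ι t * u x) lefts-x rights-x) (cong₂ (λ s t → ι s * ι t * u y) lefts-y rights-y)) ⟨
        ι (m ℕ.+ n) * (α c′ + (ι (lefts c x) * ι (rights c x) * u x + ι (lefts c y) * ι (rights c y) * u y))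
          ≡⟨ cong (ι (m ℕ.+ n) *_) α-merge ⟩
        ι (m ℕ.+ n) * (α c + (ι (lefts c x) + ι (lefts c y)) * (ι (rights c x) + ι (rights c y)) * u′)
          ≡⟨ cong (λ s → ι (m ℕ.+ n) * (α c + s * u′)) (cong₂ _*_ (cong₂ (λ s t → ι s + ι t) lefts-x lefts-y) (cong₂ (λ s t → ι s + ι t) rights-x rights-y)) ⟩
        ι (m ℕ.+ n) * (α c + (ι 1 + ι 0) * (ι 0 + ι 1) * u′)
          ≡⟨ solve 3 (λ s α u′ → s :* (α :+ (con 1ℚ :+ con 0ℚ) :* (con 0ℚ :+ con 1ℚ) :* u′) := s :* u′ :+ s :* α) refl (ι (m ℕ.+ n)) (α c) u′ ⟩
        ι (m ℕ.+ n) * u′ + ι (m ℕ.+ n) * α c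
          ≡⟨ cong₂ _+_ (trans (cong (_* u′) (sym degree-sum)) merged-inverse) α-c ⟩
        ι (suc k) ∎
        where
        u : Fin (suc N) → ℚ
        u z = ι⁻¹ (degree c z)
        u′ : ℚ
        u′ = ι⁻¹ (degree c′ x′)

    matchingForest : ∀ {k} (M : Matching k m n) → MatchingForest M
    matchingForest {zero}  M = empty-matchingForest M
    matchingForest {suc k} M = extend-matchingForest M (matchingForest (dropFirst M))

    -- The number of trees containing a matching, and the ratio

    -- One factor m n comes from the tree formula and `k` from the merges; m + n clears 1 - k / (m +
    -- n). The constant `degrees discrete`, which is n^m m^n, stays unevaluated because it is the
    -- same for every `k`.
    τ-formula : ∀ {k} (M : Matching k m n) (dec : Decidable (SpanningTreeContaining M)) → k ℕ.< m ℕ.+ n →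
      ι (τ M dec) * ι ((m ℕ.* n) ℕ.^ suc k ℕ.* (m ℕ.+ n)) ≡ degrees discrete * ι ((m ℕ.+ n) ℕ.^ k ℕ.* (m ℕ.+ n ℕ.∸ k))
    τ-formula {k} M dec k<m+n with matchingForest M
    ... | record { components = zero ; components+k = eq } = contradiction (sym eq) (ℕ.<⇒≢ k<m+n ∘ sym)
    ... | record
      { components = suc N ; components+k = N+k ; edges = F ; label = c ; forest = forest
      ; matched-edge = matched ; edge-matched = edge-matched
      ; degrees-label = degrees-c ; α-label = α-c } = begin
        ι (τ M dec) * ι (m ℕ.* n ℕ.* pow ℕ.* (m ℕ.+ n))
          ≡⟨ cong₂ _*_ (cong ι τ≡trees) (trans (ι-* (m ℕ.* n ℕ.* pow) (m ℕ.+ n)) (cong (_* ι (m ℕ.+ n)) (trans (ι-* (m ℕ.* n) pow) (cong (_* ι pow) (ι-* m n))))) ⟩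
        ι (trees F) * (ι m * ι n * ι pow * ι (m ℕ.+ n))
          ≡⟨ solve 4 (λ t mn p s → t :* (mn :* p :* s) := mn :* t :* p :* s) refl (ι (trees F)) (ι m * ι n) (ι pow) (ι (m ℕ.+ n)) ⟩
        ι m * ι n * ι (trees F) * ι pow * ι (m ℕ.+ n)
          ≡⟨ cong (λ s → s * ι pow * ι (m ℕ.+ n)) (tree-formula (λ _ _ f → f) forest) ⟩
        degrees c * (1ℚ - α c) * ι pow * ι (m ℕ.+ n)
          ≡⟨ solve 4 (λ d α p s → d :* (con 1ℚ :- α) :* p :* s := d :* p :* (s :- s :* α)) refl (degrees c) (α c) (ι pow) (ι (m ℕ.+ n)) ⟩
        degrees c * ι pow * (ι (m ℕ.+ n) - ι (m ℕ.+ n) * α c)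
          ≡⟨ cong₂ (λ s t → s * (ι (m ℕ.+ n) - t)) degrees-c α-c ⟩
        degrees discrete * ι ((m ℕ.+ n) ℕ.^ k) * (ι (m ℕ.+ n) - ι k)
          ≡⟨ cong (λ s → degrees discrete * ι ((m ℕ.+ n) ℕ.^ k) * (s - ι k)) (trans (cong ι (sym (ℕ.m∸n+n≡m (ℕ.<⇒≤ k<m+n)))) (ι-+ (m ℕ.+ n ℕ.∸ k) k)) ⟩
        degrees discrete * ι ((m ℕ.+ n) ℕ.^ k) * (ι (m ℕ.+ n ℕ.∸ k) + ι k - ι k)
          ≡⟨ solve 4 (λ d p N k → d :* p :* (N :+ k :- k) := d :* (p :* N)) refl (degrees discrete) (ι ((m ℕ.+ n) ℕ.^ k)) (ι (m ℕ.+ n ℕ.∸ k)) (ι k) ⟩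
        degrees discrete * (ι ((m ℕ.+ n) ℕ.^ k) * ι (m ℕ.+ n ℕ.∸ k))
          ≡⟨ cong (degrees discrete *_) (ι-* ((m ℕ.+ n) ℕ.^ k) (m ℕ.+ n ℕ.∸ k)) ⟨
        degrees discrete * ι ((m ℕ.+ n) ℕ.^ k ℕ.* (m ℕ.+ n ℕ.∸ k)) ∎
      where
      pow : ℕ
      pow = (m ℕ.* n) ℕ.^ k
      F⊆⇒contains : ∀ {S} → IsSpanningTree S → F ⊆ S → SpanningTreeContaining M S
      F⊆⇒contains tree F⊆S = tree , λ a → F⊆S _ _ (matched a)
      contains⇒F⊆ : ∀ {S} → SpanningTreeContaining M S → F ⊆ S
      contains⇒F⊆ (_ , contains) i j f with edge-matched i j f
      ... | a , refl , refl = contains a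
      -- `F` has exactly the edges of `M`, so a tree contains `M` if and only if it contains `F`,
      -- and `F` itself can be the base forest `F₀`.
      open TreeFormula dec {F} proj₁ F⊆⇒contains using (tree-formula)
      open TreeCount dec {F} proj₁ F⊆⇒contains using (trees; counted?)
      τ≡trees : τ M dec ≡ trees F
      τ≡trees = trans (length-filter dec (allEdgeSets m n)) (∑ₗ-cong (allEdgeSets m n) λ S →
        𝟙-cong (dec S) (counted? F S) (λ s → s , contains⇒F⊆ s) proj₁)

    -- The formulas for `M'` and `M` share (m n)^(k+1) (m + n), which is multiplied in and cancelled
    -- at the end; `W` merely passes from one formula to the other.
    τ-ratio : ∀ {k} (M : Matching k m n) (M' : Matching (suc k) m n)
      (dec : Decidable (SpanningTreeContaining M)) (dec' : Decidable (SpanningTreeContaining M')) → suc k ℕ.< m ℕ.+ n →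
      τ M' dec' ℕ.* (m ℕ.* n ℕ.* (m ℕ.+ n ℕ.∸ k)) ≡ τ M dec ℕ.* ((m ℕ.+ n) ℕ.* (m ℕ.+ n ℕ.∸ k ℕ.∸ 1))
    τ-ratio {k} M M' dec dec' 1+k<s = ι-injective _ _ (ι-cancelˡ (pow ℕ.* s) {{nonZero}} (begin
      ι (pow ℕ.* s) * ι (t′ ℕ.* (m ℕ.* n ℕ.* r))
        ≡⟨ cong₂ _*_ (ι-* pow s) (trans (ι-* t′ (m ℕ.* n ℕ.* r)) (cong (ι t′ *_) (ι-* (m ℕ.* n) r))) ⟩
      ι pow * ι s * (ι t′ * (ι (m ℕ.* n) * ι r))
        ≡⟨ solve 5 (λ p s t mn r → p :* s :* (t :* (mn :* r)) := t :* (mn :* p :* s) :* r) refl (ι pow) (ι s) (ι t′) (ι (m ℕ.* n)) (ι r) ⟩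
      ι t′ * (ι (m ℕ.* n) * ι pow * ι s) * ι r
        ≡⟨ cong (λ q → ι t′ * q * ι r) (trans (ι-* (m ℕ.* n ℕ.* pow) s) (cong (_* ι s) (ι-* (m ℕ.* n) pow))) ⟨
      ι t′ * ι (m ℕ.* n ℕ.* pow ℕ.* s) * ι r
        ≡⟨ cong (_* ι r) (τ-formula M' dec' 1+k<s) ⟩
      W * ι (s ℕ.* s ℕ.^ k ℕ.* (s ℕ.∸ suc k)) * ι r
        ≡⟨ cong (λ q → W * q * ι r) (trans (ι-* (s ℕ.* s ℕ.^ k) (s ℕ.∸ suc k)) (cong₂ _*_ (ι-* s (s ℕ.^ k)) (cong ι (sym r∸1)))) ⟩
      W * (ι s * ι (s ℕ.^ k) * ι (r ℕ.∸ 1)) * ι r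
        ≡⟨ solve 5 (λ W s e q r → W :* (s :* e :* q) :* r := W :* (e :* r) :* (s :* q)) refl W (ι s) (ι (s ℕ.^ k)) (ι (r ℕ.∸ 1)) (ι r) ⟩
      W * (ι (s ℕ.^ k) * ι r) * (ι s * ι (r ℕ.∸ 1))
        ≡⟨ cong (λ q → W * q * (ι s * ι (r ℕ.∸ 1))) (ι-* (s ℕ.^ k) r) ⟨
      W * ι (s ℕ.^ k ℕ.* r) * (ι s * ι (r ℕ.∸ 1))
        ≡⟨ cong (_* (ι s * ι (r ℕ.∸ 1))) (τ-formula M dec (ℕ.<-trans (ℕ.n<1+n k) 1+k<s)) ⟨
      ι t * ι (pow ℕ.* s) * (ι s * ι (r ℕ.∸ 1))
        ≡⟨ solve 3 (λ t p q → t :* p :* q := p :* (t :* q)) refl (ι t) (ι (pow ℕ.* s)) (ι s * ι (r ℕ.∸ 1)) ⟩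
      ι (pow ℕ.* s) * (ι t * (ι s * ι (r ℕ.∸ 1)))
        ≡⟨ cong (ι (pow ℕ.* s) *_) (trans (ι-* t (s ℕ.* (r ℕ.∸ 1))) (cong (ι t *_) (ι-* s (r ℕ.∸ 1)))) ⟨
      ι (pow ℕ.* s) * ι (t ℕ.* (s ℕ.* (r ℕ.∸ 1))) ∎))
      where
      s r t t′ pow : ℕ
      s = m ℕ.+ n
      r = s ℕ.∸ k
      t = τ M dec
      t′ = τ M' dec'
      pow = (m ℕ.* n) ℕ.^ suc k
      W : ℚ
      W = degrees discrete
      r∸1 : r ℕ.∸ 1 ≡ s ℕ.∸ suc k
      r∸1 = trans (ℕ.∸-+-assoc s k 1) (cong (s ℕ.∸_) (ℕ.+-comm k 1))
      nonZero : ℕ.NonZero (pow ℕ.* s)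
      nonZero = ℕ.m*n≢0 pow s {{ℕ.m^n≢0 (m ℕ.* n) (suc k) {{ℕ.m*n≢0 m n}}}} {{ℕ.>-nonZero (ℕ.≤-<-trans z≤n 1+k<s)}}

open import Data.Nat using (_+_; _*_; _∸_; _≤_)

theorem3p2 : (m n k : ℕ) → 1 ≤ k → suc k ≤ m → suc k ≤ n →
    (M : Matching k m n) (M' : Matching (suc k) m n) →
    (dec : Decidable (SpanningTreeContaining M)) →
    (dec' : Decidable (SpanningTreeContaining M')) →
    τ M' dec' * (m * n * (m + n ∸ k)) ≡ τ M dec * ((m + n) * (m + n ∸ k ∸ 1))
theorem3p2 m n k _ k<m k<n M M' dec dec' =
  Weights.Weight.τ-ratio m n {{ℕ.>-nonZero 0<m}} {{ℕ.>-nonZero 0<n}} M M' dec dec'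
    (ℕ.≤-<-trans k<m (ℕ.m<m+n m 0<n))
  where
  0<m : 0 ℕ.< m
  0<m = ℕ.≤-<-trans z≤n k<m
  0<n : 0 ℕ.< n
  0<n = ℕ.≤-<-trans z≤n k<n
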